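{- For every bridgeless graph $G$ with radius $r$ and $\zeta=iso(G)$, $$rc(G)\le \sum_{i=1}^{r}\min\{2i+1,\zeta\}\le r\zeta.$$ Moreover, for every two integers $r\ge 1$ and $3\le\zeta\le 2r+1$, there exists a bridgeless graph $G$ with radius $r$ and $iso(G)=\zeta$ such that $rc(G)=\sum_{i=1}^{r}\min\{2i+1,\zeta\}$.
   Context: All graphs are finite, simple and undirected. A bridgeless graph is a connected graph with no bridge (an edge whose removal disconnects the graph). The radius of a connected graph is $\min_{v}\max_{x} d_G(v,x)$. An edge colouring is a rainbow colouring if every pair of vertices is joined by a path whose edges have pairwise distinct colours; $rc(G)$, the rainbow connection number, is the minimum number of colours in a rainbow colouring of $G$. A subgraph $H$ of $G$ is isometric if distances between vertices of $H$ are the same in $H$ as in $G$; $iso(G)$ is the length of a largest isometric cycle of $G$. -}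

module Defs where

open import Data.Nat using (ℕ; zero; suc; _+_; _*_; _∸_; _≤_; _⊓_; ∣_-_∣)
open import Data.Fin using (Fin; toℕ; _≟_)
open import Data.Bool using (Bool; true; false; _∧_; not)
open import Data.List using (List; []; _∷_)
open import Data.List.Relation.Unary.Unique.Propositional using (Unique)
open import Data.Product using (Σ; ∃; _×_)
open import Function.Definitions using (Injective)
open import Relation.Binary.PropositionalEquality using (_≡_)
open import Relation.Nullary.Decidable using (⌊_⌋)

record Graph (n : ℕ) : Set where
  field
    adj     : Fin n → Fin n → Bool
    adj-sym : ∀ u v → adj u v ≡ adj v u
    irrefl  : ∀ v → adj v v ≡ false
open Graph public

data Walk {n : ℕ} (G : Graph n) : Fin n → Fin n → Set where
  []  : ∀ {x} → Walk G x x
  _∷_ : ∀ {x y z} → adj G x y ≡ true → Walk G y z → Walk G x z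

length : ∀ {n} {G : Graph n} {x y} → Walk G x y → ℕ
length []      = 0
length (_ ∷ p) = suc (length p)

vertices : ∀ {n} {G : Graph n} {x y} → Walk G x y → List (Fin n)
vertices {x = x} []      = x ∷ []
vertices {x = x} (_ ∷ p) = x ∷ vertices p

colours : ∀ {n k} {G : Graph n} {x y} → (Fin n → Fin n → Fin k) → Walk G x y → List (Fin k)
colours c []               = []
colours c (_∷_ {x} {y} _ p) = c x y ∷ colours c p

IsPath : ∀ {n} {G : Graph n} {x y} → Walk G x y → Set
IsPath p = Unique (vertices p)

Dist : ∀ {n} → Graph n → Fin n → Fin n → ℕ → Set
Dist G x y k = (Σ (Walk G x y) λ p → length p ≡ k) × (∀ (p : Walk G x y) → k ≤ length p)

DistLE : ∀ {n} → Graph n → Fin n → Fin n → ℕ → Set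
DistLE G x y k = Σ (Walk G x y) λ p → length p ≤ k

Connected : ∀ {n} → Graph n → Set
Connected G = ∀ x y → Walk G x y

deleteEdge : ∀ {n} → Graph n → Fin n → Fin n → Graph n
deleteEdge G u v = record
  { adj = λ x y → adj G x y ∧ not ((⌊ x ≟ u ⌋ ∧ ⌊ y ≟ v ⌋) Data.Bool.∨ (⌊ x ≟ v ⌋ ∧ ⌊ y ≟ u ⌋))
  ; adj-sym = λ x y → helper x y
  ; irrefl = λ x → irr x }
  where
  open import Data.Bool.Properties using (∨-comm)
  open import Relation.Binary.PropositionalEquality using (cong₂; refl)
  open import Data.Bool using (_∨_)
  helper : ∀ x y → (adj G x y ∧ not ((⌊ x ≟ u ⌋ ∧ ⌊ y ≟ v ⌋) ∨ (⌊ x ≟ v ⌋ ∧ ⌊ y ≟ u ⌋)))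
                 ≡ (adj G y x ∧ not ((⌊ y ≟ u ⌋ ∧ ⌊ x ≟ v ⌋) ∨ (⌊ y ≟ v ⌋ ∧ ⌊ x ≟ u ⌋)))
  helper x y rewrite adj-sym G x y
                   | Data.Bool.Properties.∧-comm ⌊ x ≟ u ⌋ ⌊ y ≟ v ⌋
                   | Data.Bool.Properties.∧-comm ⌊ x ≟ v ⌋ ⌊ y ≟ u ⌋
                   | ∨-comm (⌊ y ≟ v ⌋ ∧ ⌊ x ≟ u ⌋) (⌊ y ≟ u ⌋ ∧ ⌊ x ≟ v ⌋) = refl
  irr : ∀ x → (adj G x x ∧ _) ≡ false
  irr x rewrite irrefl G x = refl

IsBridge : ∀ {n} → Graph n → Fin n → Fin n → Set
IsBridge G u v = (adj G u v ≡ true) × (Connected (deleteEdge G u v) → Data.Empty.⊥)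
  where import Data.Empty

Bridgeless : ∀ {n} → Graph n → Set
Bridgeless G = Connected G × (∀ u v → adj G u v ≡ true → Connected (deleteEdge G u v))

Radius : ∀ {n} → Graph n → ℕ → Set
Radius G r = (∃ λ v → ∀ x → DistLE G v x r)
           × (∀ v → ∃ λ x → ∀ (p : Walk G v x) → r ≤ length p)

cycDist : ∀ {L} → Fin L → Fin L → ℕ
cycDist {L} i j = ∣ toℕ i - toℕ j ∣ ⊓ (L ∸ ∣ toℕ i - toℕ j ∣)

record IsoCycle {n} (G : Graph n) (L : ℕ) : Set where
  field
    three≤L   : 3 ≤ L
    vert      : Fin L → Fin n
    injective : Injective _≡_ _≡_ vert
    edges     : ∀ i j → cycDist i j ≡ 1 → adj G (vert i) (vert j) ≡ true
    isometric : ∀ i j → Dist G (vert i) (vert j) (cycDist i j)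

Iso : ∀ {n} → Graph n → ℕ → Set
Iso G ζ = IsoCycle G ζ × (∀ L → IsoCycle G L → L ≤ ζ)

record RainbowColouring {n} (G : Graph n) (k : ℕ) : Set where
  field
    colour    : Fin n → Fin n → Fin k
    symmetric : ∀ u v → colour u v ≡ colour v u
    rainbow   : ∀ x y → Σ (Walk G x y) λ p → IsPath p × Unique (colours colour p)

RcLE : ∀ {n} → Graph n → ℕ → Set
RcLE G k = RainbowColouring G k

Rc : ∀ {n} → Graph n → ℕ → Set
Rc G k = RainbowColouring G k × (∀ m → RainbowColouring G m → k ≤ m)

bound : ℕ → ℕ → ℕ
bound ζ zero    = 0
bound ζ (suc r) = bound ζ r + ((2 * suc r + 1) ⊓ ζ)

-- Upper bound. Start from the centre, which dominates G within distance r, and repeatedly enlarge a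
-- rainbow coloured dominating set D, lowering its domination distance from k to k − 1 with
-- N = min{2k+1, ζ} fresh colours. The breadth-first forest of D splits the other vertices into
-- branches. A shortest cycle through an edge is isometric, so each edge leaving D lies on a cycle of
-- length at most ζ, and its branch has either a second edge to D or an edge u v to another branch with
-- d(u) + d(v) < N. A maximal independent set of branches marks each branch as low or high so that
-- each one with such a neighbour has one of the opposite kind. Give a vertex v level d(v) on a low
-- branch and N − d(v) on a high one, and colour an edge outside D by the smaller level of its ends.
-- Every added vertex then reaches D by a rainbow walk with colours below its level, and by another
-- with colours at or above it; two added vertices are joined by going down from the one of smaller
-- level and up from the other.
--
-- Sharpness. Chain cycles of lengths min{2i+1, ζ}, i = r, …, 1, each sharing with the next a cut vertex
-- adjacent to the previous one, and glue many copies of the chain at its centre. Two copies are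
-- coloured alike; a rainbow path between their far ends must, in each cycle, take the short edge in
-- one copy and the whole long arc in the other, so it uses all edge colours of the chain, without
-- repetition.
module Submission where

open import Defs
open import Relation.Binary.PropositionalEquality
  using (_≡_; _≢_; refl; sym; trans; cong; cong₂; subst; subst₂; setoid)
open import Data.Nat
  using (ℕ; zero; suc; pred; >-nonZero; _+_; _*_; _∸_; _^_; _≤_; _<_; _⊓_; _⊔_; ∣_-_∣; z≤n; s≤s; _≤?_; _<?_)
open import Data.Nat.Properties renaming (_≟_ to _≟ℕ_)
open import Data.Nat.GeneralisedArithmetic using (fold)
open import Data.Nat.DivMod using (_mod_; m%n<n; m≤n⇒m%n≡m)
open import Data.Nat.Induction using (<-rec)
open import Data.Nat.Solver using (module +-*-Solver)
open import Data.Fin using (Fin; zero; suc; toℕ; fromℕ<; _≟_; combine; remQuot; splitAt; join; funToFin; finToFun)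
open import Data.Fin.Properties
  using (any?; toℕ<n; toℕ-fromℕ<; toℕ-injective; fromℕ<-toℕ; combine-injective; remQuot-combine; combine-remQuot;
         pigeonhole; splitAt-join; join-splitAt; finToFun-funToFin)
import Data.Fin.Properties as Fin
open import Data.Bool using (Bool; true; false; _∨_; if_then_else_)
import Data.Bool.Properties as 𝔹
open import Data.List using (List; []; _∷_; _++_; reverse; map)
open import Data.List.Properties using (unfold-reverse)
open import Data.List.Membership.Propositional using (_∈_)
open import Data.List.Relation.Binary.Permutation.Setoid (setoid ℕ) using (↭-sym)
import Data.List.Relation.Binary.Permutation.Setoid.Properties (setoid ℕ) as Permutation
import Data.List.Membership.DecPropositional as DecMembership
open import Data.List.Relation.Unary.All as All using (All; []; _∷_)
import Data.List.Relation.Unary.All.Properties as All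
open import Data.List.Relation.Unary.Any using (here; there)
open import Data.List.Relation.Unary.AllPairs using ([]; _∷_)
open import Data.List.Relation.Unary.Unique.Propositional using (Unique)
import Data.List.Relation.Unary.Unique.Propositional.Properties as Unique
open import Data.Product using (Σ; ∃; ∃₂; _×_; _,_; proj₁; proj₂)
open import Data.Sum using (_⊎_; inj₁; inj₂; [_,_]′)
open import Data.Empty using (⊥)
open import Function using (_∘_; id; case_of_)
open import Function.Definitions using (Injective)
open import Relation.Nullary using (¬_; Dec; yes; no; does)
open import Relation.Nullary.Negation using (contradiction)
open import Relation.Nullary.Decidable using (_×-dec_; _⊎-dec_; map′; ¬?; dec-true; dec-false)

private variable
  n : ℕ
  G : Graph n
  a b c x y z : Fin n

-- Least witnesses of decidable predicates

module _ {P : ℕ → Set} (P? : ∀ k → Dec (P k)) where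

  least : ∀ {k} → P k → ∃ λ m → P m × (∀ {j} → P j → m ≤ j)
  least {k} = <-rec (λ k → P k → ∃ λ m → P m × (∀ {j} → P j → m ≤ j)) step k
    where
    step : ∀ k → (∀ {j} → j < k → P j → ∃ λ m → P m × (∀ {i} → P i → m ≤ i)) →
           P k → ∃ λ m → P m × (∀ {j} → P j → m ≤ j)
    step k rec Pk with any? {n = k} (λ i → P? (toℕ i))
    ... | yes (i , Pi) = rec (toℕ<n i) Pi
    ... | no  none     = k , Pk , λ {j} Pj → ≮⇒≥ λ j<k →
      none (fromℕ< j<k , subst P (sym (toℕ-fromℕ< j<k)) Pj)

-- Walks and deleted edges

infixr 5 _++ʷ_
_++ʷ_ : Walk G x y → Walk G y z → Walk G x z
[]      ++ʷ q = q
(e ∷ p) ++ʷ q = e ∷ (p ++ʷ q)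

length-++ʷ : (p : Walk G x y) (q : Walk G y z) → length (p ++ʷ q) ≡ length p + length q
length-++ʷ []      q = refl
length-++ʷ (e ∷ p) q = cong suc (length-++ʷ p q)

revʷ : Walk G x y → Walk G y x
revʷ         []                = []
revʷ {G = G} (_∷_ {x} {y} e p) = revʷ p ++ʷ (trans (adj-sym G y x) e ∷ [])

length-revʷ : (p : Walk G x y) → length (revʷ p) ≡ length p
length-revʷ []      = refl
length-revʷ (e ∷ p) = trans (length-++ʷ (revʷ p) _) (trans (+-comm _ 1) (cong suc (length-revʷ p)))

-- Lengths are exact because exact lengths add under concatenation, and for a fixed length existence
-- is decidable by recursion; least lengths are then found by search.
Reach : Graph n → ℕ → Fin n → Fin n → Set
Reach G k x y = Σ (Walk G x y) λ p → length p ≡ k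

reach-++ : ∀ {k l} → Reach G k x y → Reach G l y z → Reach G (k + l) x z
reach-++ (p , refl) (q , refl) = p ++ʷ q , length-++ʷ p q

reach-rev : ∀ {k} → Reach G k x y → Reach G k y x
reach-rev (p , refl) = revʷ p , length-revʷ p

reach-edge : adj G x y ≡ true → Reach G 1 x y
reach-edge e = e ∷ [] , refl

reach? : (G : Graph n) (k : ℕ) (x y : Fin n) → Dec (Reach G k x y)
reach? G zero x y = map′ (λ { refl → [] , refl }) (λ { ([] , _) → refl }) (x ≟ y)
reach? G (suc k) x y =
  map′ (λ { (z , e , p , refl) → e ∷ p , refl })
       (λ { (_∷_ {y = z} e p , refl) → z , e , p , refl })
       (any? λ z → (adj G x z 𝔹.≟ true) ×-dec reach? G k z y)

shortest : (G : Graph n) → Walk G x y → Σ (Walk G x y) λ p → ∀ q → length p ≤ length q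
shortest {x = x} {y} G p with least (λ k → reach? G k x y) (p , refl)
... | _ , (q , refl) , min = q , λ q′ → min (q′ , refl)

-- Source of the distance lower bounds in the extremal graphs: each comes from a height function
-- that no edge raises by more than one.
lipschitz : (h : Fin n → ℕ) → (∀ {u v} → adj G u v ≡ true → h v ≤ suc (h u)) →
            (p : Walk G x y) → h y ≤ h x + length p
lipschitz h lip [] = ≤-reflexive (sym (+-identityʳ _))
lipschitz h lip (_∷_ {x} {y} {z} e p) = begin
  h z                  ≤⟨ lipschitz h lip p ⟩
  h y + length p       ≤⟨ +-monoˡ-≤ (length p) (lip e) ⟩
  suc (h x + length p) ≡⟨ sym (+-suc (h x) (length p)) ⟩
  h x + suc (length p) ∎
  where open ≤-Reasoning

SameEdge : Fin n → Fin n → Fin n → Fin n → Set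
SameEdge a b x y = (x ≡ a × y ≡ b) ⊎ (x ≡ b × y ≡ a)

sameEdge? : (a b x y : Fin n) → Dec (SameEdge a b x y)
sameEdge? a b x y = ((x ≟ a) ×-dec (y ≟ b)) ⊎-dec ((x ≟ b) ×-dec (y ≟ a))

module _ (G : Graph n) where

  delete-edge⁻ : adj (deleteEdge G a b) x y ≡ true → adj G x y ≡ true × ¬ SameEdge a b x y
  delete-edge⁻ {a} {b} {x} {y} e with adj G x y | x ≟ a | y ≟ b | x ≟ b | y ≟ a
  ... | true | no x≢a | _      | no x≢b | _      = refl , λ { (inj₁ (p , _)) → x≢a p ; (inj₂ (p , _)) → x≢b p }
  ... | true | no x≢a | _      | yes _  | no y≢a = refl , λ { (inj₁ (p , _)) → x≢a p ; (inj₂ (_ , p)) → y≢a p }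
  ... | true | yes _  | no y≢b | no x≢b | _      = refl , λ { (inj₁ (_ , p)) → y≢b p ; (inj₂ (p , _)) → x≢b p }
  ... | true | yes _  | no y≢b | yes _  | no y≢a = refl , λ { (inj₁ (_ , p)) → y≢b p ; (inj₂ (_ , p)) → y≢a p }

  delete-edge⁺ : adj G x y ≡ true → ¬ SameEdge a b x y → adj (deleteEdge G a b) x y ≡ true
  delete-edge⁺ {x} {y} {a} {b} e ≢ab with adj G x y | x ≟ a | y ≟ b | x ≟ b | y ≟ a
  ... | true | yes p | yes q | _     | _     = contradiction (inj₁ (p , q)) ≢ab
  ... | true | yes _ | no  _ | no _  | _     = refl
  ... | true | yes _ | no  _ | yes _ | no _  = refl
  ... | true | yes _ | no  _ | yes p | yes q = contradiction (inj₂ (p , q)) ≢ab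
  ... | true | no _  | _     | no _  | _     = refl
  ... | true | no _  | _     | yes _ | no _  = refl
  ... | true | no _  | _     | yes p | yes q = contradiction (inj₂ (p , q)) ≢ab

  undelete : Walk (deleteEdge G a b) x y → Walk G x y
  undelete []      = []
  undelete (e ∷ p) = proj₁ (delete-edge⁻ e) ∷ undelete p

  length-undelete : (p : Walk (deleteEdge G a b) x y) → length (undelete p) ≡ length p
  length-undelete []      = refl
  length-undelete (e ∷ p) = cong suc (length-undelete p)

  reach-undelete : ∀ {k} → Reach (deleteEdge G a b) k x y → Reach G k x y
  reach-undelete (p , refl) = undelete p , length-undelete p

-- Isometric cycles

dist-sym : ∀ {k} → Dist G x y k → Dist G y x k
dist-sym (p , min) = reach-rev p , λ q → subst (_ ≤_) (length-revʷ q) (min (revʷ q))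

at : {G : Graph n} → Walk G x y → ℕ → Fin n
at {x = x} []      _       = x
at {x = x} (_ ∷ _) zero    = x
at         (_ ∷ p) (suc i) = at p i

at-start : (p : Walk G x y) → at p 0 ≡ x
at-start []      = refl
at-start (_ ∷ _) = refl

at-end : (p : Walk G x y) → at p (length p) ≡ y
at-end []      = refl
at-end (_ ∷ p) = at-end p

segment : (p : Walk G x y) (i k : ℕ) → i + k ≤ length p → Reach G k (at p i) (at p (i + k))
segment p       zero    zero    _       = [] , refl
segment {G = G} {x} (e ∷ p) zero (suc k) (s≤s h) =
  reach-++ (reach-edge (subst (λ w → adj G x w ≡ true) (sym (at-start p)) e)) (segment p 0 k h)
segment (e ∷ p) (suc i) k       (s≤s h) = segment p i k h

-- The numbers `i`, `k`, `r` cut the cycle at two of its vertices: one arc has length `k`, the other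
-- runs through the closing edge and has length `suc (i + r)`. Adjacency and injectivity need no
-- separate hypotheses, since they are read off from distances 1 and 0.
isoCycle : (m : ℕ) {G : Graph n} (v : ℕ → Fin n) → 2 ≤ m →
           (∀ i k r → i + k + r ≡ m →
             Reach G k (v i) (v (i + k)) × Reach G (suc (i + r)) (v i) (v (i + k)) ×
             (∀ (q : Walk G (v i) (v (i + k))) → k ≤ length q ⊎ suc (i + r) ≤ length q)) →
           IsoCycle G (suc m)
isoCycle m {G} v 2≤m arcs = record
  { three≤L   = s≤s 2≤m
  ; vert      = vert
  ; injective = inj _ _
  ; edges     = λ i j d≡1 → edge (subst (Dist G (vert i) (vert j)) d≡1 (dist i j))
  ; isometric = dist
  }
  where
  vert : Fin (suc m) → _
  vert i = v (toℕ i)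

  arc-dist : ∀ i k r → i + k + r ≡ m → Dist G (v i) (v (i + k)) (k ⊓ suc (i + r))
  arc-dist i k r eq with arcs i k r eq | ≤-total k (suc (i + r))
  ... | short , _ , min | inj₁ k≤ = subst (λ d → Reach G d _ _) (sym (m≤n⇒m⊓n≡m k≤)) short ,
    λ q → [ ≤-trans (m⊓n≤m k _) , ≤-trans (m⊓n≤n k _) ]′ (min q)
  ... | _ , long , min | inj₂ k≥ = subst (λ d → Reach G d _ _) (sym (m≥n⇒m⊓n≡n k≥)) long ,
    λ q → [ ≤-trans (m⊓n≤m k _) , ≤-trans (m⊓n≤n k _) ]′ (min q)

  dist-≤ : ∀ i j → toℕ i ≤ toℕ j → Dist G (vert i) (vert j) (cycDist i j)
  dist-≤ i j i≤j = subst₂ (λ w d → Dist G (vert i) w d)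
    (cong v (m+[n∸m]≡n i≤j)) (cong₂ _⊓_ (sym gap) rest)
    (arc-dist (toℕ i) (toℕ j ∸ toℕ i) (m ∸ toℕ j)
      (trans (cong (_+ (m ∸ toℕ j)) (m+[n∸m]≡n i≤j)) (m+[n∸m]≡n j≤m)))
    where
    j≤m : toℕ j ≤ m
    j≤m = ≤-pred (toℕ<n j)
    gap : ∣ toℕ i - toℕ j ∣ ≡ toℕ j ∸ toℕ i
    gap = m≤n⇒∣m-n∣≡n∸m i≤j
    open ≤-Reasoning
    rest : suc (toℕ i + (m ∸ toℕ j)) ≡ suc m ∸ ∣ toℕ i - toℕ j ∣
    rest = begin-equality
      suc (toℕ i) + (m ∸ toℕ j)                          ≡⟨ cong suc (+-comm (toℕ i) _) ⟩
      suc ((m ∸ toℕ j) + toℕ i)                          ≡⟨ cong suc (sym (regroup)) ⟩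
      suc (m ∸ (toℕ j ∸ toℕ i))                          ≡⟨ sym (+-∸-assoc 1 (≤-trans (m∸n≤m (toℕ j) (toℕ i)) j≤m)) ⟩
      suc m ∸ (toℕ j ∸ toℕ i)                            ≡⟨ cong (suc m ∸_) (sym gap) ⟩
      suc m ∸ ∣ toℕ i - toℕ j ∣                          ∎
      where
      regroup : m ∸ (toℕ j ∸ toℕ i) ≡ (m ∸ toℕ j) + toℕ i
      regroup = begin-equality
        m ∸ (toℕ j ∸ toℕ i)                              ≡⟨ cong (_∸ (toℕ j ∸ toℕ i)) (sym (m∸n+n≡m j≤m)) ⟩
        (m ∸ toℕ j) + toℕ j ∸ (toℕ j ∸ toℕ i)            ≡⟨ +-∸-assoc (m ∸ toℕ j) (m∸n≤m (toℕ j) (toℕ i)) ⟩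
        (m ∸ toℕ j) + (toℕ j ∸ (toℕ j ∸ toℕ i))          ≡⟨ cong ((m ∸ toℕ j) +_) (m∸[m∸n]≡n i≤j) ⟩
        (m ∸ toℕ j) + toℕ i                              ∎

  dist : ∀ i j → Dist G (vert i) (vert j) (cycDist i j)
  dist i j with ≤-total (toℕ i) (toℕ j)
  ... | inj₁ i≤j = dist-≤ i j i≤j
  ... | inj₂ j≤i = subst (Dist G (vert i) (vert j))
    (cong (λ d → d ⊓ (suc m ∸ d)) (∣-∣-comm (toℕ j) (toℕ i))) (dist-sym (dist-≤ j i j≤i))

  edge : Dist G x y 1 → adj G x y ≡ true
  edge ((e ∷ [] , refl) , _) = e

  inj : ∀ i j → vert i ≡ vert j → i ≡ j
  inj i j eq with n≤0⇒n≡0 (proj₂ (subst (λ w → Dist G (vert i) w (cycDist i j)) (sym eq) (dist i j)) [])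
  ... | d≡0 = toℕ-injective (∣m-n∣≡0⇒m≡n (n≤0⇒n≡0 (≮⇒≥ λ 0<d →
    <⇒≢ (⊓-pres-m< 0<d (m<n⇒0<n∸m (s≤s gap≤m))) (sym d≡0))))
    where
    gap≤m : ∣ toℕ i - toℕ j ∣ ≤ m
    gap≤m = ≤-trans (∣m-n∣≤m⊔n (toℕ i) (toℕ j)) (⊔-lub (≤-pred (toℕ<n i)) (≤-pred (toℕ<n j)))

module _ (G : Graph n) {a b : Fin n} where

  private
    G′ = deleteEdge G a b

    -- A walk that uses the edge, cut at its first and last use: `c` is where the edge is first
    -- entered and `d` where it is last left. Whatever happens in between is dropped, hence an
    -- inequality for the length.
    Detour : Fin n → Fin n → ℕ → Set
    Detour x y l = ∃₂ λ c d → (c ≡ a ⊎ c ≡ b) × (d ≡ a ⊎ d ≡ b) × ∃₂ λ l₁ l₂ →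
      Reach G′ l₁ x c × Reach G′ l₂ d y × suc (l₁ + l₂) ≤ l

  avoid-or-detour : (q : Walk G x y) → DistLE G′ x y (length q) ⊎ Detour x y (length q)
  avoid-or-detour [] = inj₁ ([] , z≤n)
  avoid-or-detour (_∷_ {x} {y} e q) with sameEdge? a b x y | avoid-or-detour q
  ... | yes (inj₁ (x≡a , y≡b)) | inj₁ (p , p≤) =
    inj₂ (x , y , inj₁ x≡a , inj₂ y≡b , 0 , length p , ([] , refl) , (p , refl) , s≤s p≤)
  ... | yes (inj₂ (x≡b , y≡a)) | inj₁ (p , p≤) =
    inj₂ (x , y , inj₂ x≡b , inj₁ y≡a , 0 , length p , ([] , refl) , (p , refl) , s≤s p≤)
  ... | yes (inj₁ (x≡a , _)) | inj₂ (_ , d , _ , d∈ , l₁ , l₂ , _ , q₂ , le) =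
    inj₂ (x , d , inj₁ x≡a , d∈ , 0 , l₂ , ([] , refl) , q₂ , s≤s (≤-trans (m≤n+m l₂ (suc l₁)) le))
  ... | yes (inj₂ (x≡b , _)) | inj₂ (_ , d , _ , d∈ , l₁ , l₂ , _ , q₂ , le) =
    inj₂ (x , d , inj₂ x≡b , d∈ , 0 , l₂ , ([] , refl) , q₂ , s≤s (≤-trans (m≤n+m l₂ (suc l₁)) le))
  ... | no ≢e | inj₁ (p , p≤) = inj₁ (delete-edge⁺ G e ≢e ∷ p , s≤s p≤)
  ... | no ≢e | inj₂ (c , d , c∈ , d∈ , l₁ , l₂ , q₁ , q₂ , le) =
    inj₂ (c , d , c∈ , d∈ , suc l₁ , l₂ , reach-++ (reach-edge (delete-edge⁺ G e ≢e)) q₁ , q₂ , s≤s le)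

  -- A walk between two cycle vertices that avoids the edge `a b` could replace their arc of `p`, so
  -- minimality of `p` bounds it by that arc. A walk through the edge is cut there, and its outer
  -- pieces are compared with `p` in the same way.
  shortest⇒isoCycle : adj G a b ≡ true → (p : Walk G′ b a) → (∀ q → length p ≤ length q) →
                      IsoCycle G (suc (length p))
  shortest⇒isoCycle e p min = isoCycle (length p) (at p) (two p) λ i k r eq →
    let i+k≤ = subst (i + k ≤_) eq (m≤m+n (i + k) r)
        s₁ : Reach G′ i b (at p i)
        s₁ = subst (λ w → Reach G′ i w (at p i)) (at-start p)
               (segment p 0 i (≤-trans (m≤m+n i k) i+k≤))
        s₂ = segment p i k i+k≤
        s₃ : Reach G′ r (at p (i + k)) a
        s₃ = subst (Reach G′ r _) (trans (cong (at p) eq) (at-end p))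
               (segment p (i + k) r (≤-reflexive eq))
    in reach-undelete G s₂
     , subst (λ l → Reach G l (at p i) (at p (i + k))) (+-suc i r)
         (reach-++ (reach-rev (reach-undelete G s₁))
           (reach-++ (reach-edge (trans (adj-sym G b a) e)) (reach-rev (reach-undelete G s₃))))
     , λ q → lower i k r eq s₁ s₂ s₃ (avoid-or-detour q)
    where
    two : (p : Walk G′ b a) → 2 ≤ length p
    two [] with () ← trans (sym e) (irrefl G a)
    two (e′ ∷ []) = contradiction (inj₂ (refl , refl)) (proj₂ (delete-edge⁻ G e′))
    two (_ ∷ _ ∷ _) = s≤s (s≤s z≤n)

    lower : ∀ i k r → i + k + r ≡ length p → ∀ {u w l} → Reach G′ i b u → Reach G′ k u w → Reach G′ r w a →
            DistLE G′ u w l ⊎ Detour u w l → k ≤ l ⊎ suc (i + r) ≤ l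
    lower i k r eq {u} {w} {l} s₁ s₂ s₃ = go
      where
      min′ : ∀ {j} → Reach G′ j b a → i + k + r ≤ j
      min′ (q , refl) = subst (_≤ length q) (sym eq) (min q)

      k≤ : ∀ {j} → i + k + r ≤ i + (j + r) → k ≤ j
      k≤ {j} h = +-cancelˡ-≤ i k j (+-cancelʳ-≤ r (i + k) (i + j)
        (subst (i + k + r ≤_) (sym (+-assoc i j r)) h))

      go : _ → _
      go (inj₁ (q , q≤)) = inj₁ (≤-trans (k≤ (min′ (reach-++ s₁ (reach-++ (q , refl) s₃)))) q≤)
      -- The walk gets to `a` before using the edge; preceded by the start of `p` it competes with
      -- `p` from `b` to `a`. The next case is the mirror image at `b`.
      go (inj₂ (_ , _ , inj₁ refl , _ , l₁ , l₂ , q₁ , _ , le)) = inj₁ (begin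
        k            ≤⟨ m≤m+n k r ⟩
        k + r        ≤⟨ +-cancelˡ-≤ i _ _ (subst (_≤ i + l₁) (+-assoc i k r) (min′ (reach-++ s₁ q₁))) ⟩
        l₁           ≤⟨ m≤m+n l₁ l₂ ⟩
        l₁ + l₂      ≤⟨ n≤1+n _ ⟩
        suc (l₁ + l₂) ≤⟨ le ⟩
        l            ∎)
        where open ≤-Reasoning
      go (inj₂ (_ , _ , inj₂ _ , inj₂ refl , l₁ , l₂ , _ , q₂ , le)) = inj₁ (begin
        k            ≤⟨ m≤n+m k i ⟩
        i + k        ≤⟨ +-cancelʳ-≤ r _ _ (min′ (reach-++ q₂ s₃)) ⟩
        l₂           ≤⟨ m≤n+m l₂ (suc l₁) ⟩
        suc (l₁ + l₂) ≤⟨ le ⟩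
        l            ∎)
        where open ≤-Reasoning
      -- The edge is entered at `b` and left at `a`, as on the other arc: exchanging the first or
      -- the last part of `p` for a piece of the walk gives `i ≤ l₁` and `r ≤ l₂`.
      go (inj₂ (_ , _ , inj₂ refl , inj₁ refl , l₁ , l₂ , q₁ , q₂ , le)) =
        inj₂ (≤-trans (s≤s (+-mono-≤ i≤l₁ r≤l₂)) le)
        where
        open ≤-Reasoning
        i≤l₁ : i ≤ l₁
        i≤l₁ = +-cancelʳ-≤ (k + r) i l₁ (subst (_≤ l₁ + (k + r)) (+-assoc i k r)
          (min′ (reach-++ (reach-rev q₁) (reach-++ s₂ s₃))))
        r≤l₂ : r ≤ l₂
        r≤l₂ = +-cancelˡ-≤ (i + k) r l₂ (min′ (reach-++ (reach-++ s₁ s₂) (reach-rev q₂)))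

shortCycle : ∀ {ζ} → Bridgeless G → (∀ L → IsoCycle G L → L ≤ ζ) → adj G a b ≡ true →
             Σ (Walk (deleteEdge G a b) b a) λ p → length p < ζ
shortCycle {G = G} {a} {b} (_ , bridgeless) longest e
  with p , min ← shortest (deleteEdge G a b) (bridgeless a b e b a)
  = p , longest _ (shortest⇒isoCycle G e p min)

-- Maximal independent sets and two-sided splittings

module _ (H : Fin n → Fin n → Set) where

  Split : (Fin n → Bool) → Set
  Split side = ∀ c c′ → H c c′ → ∃ λ c″ → H c c″ × side c ≢ side c″

-- Greedy choice: the new vertex `zero` joins exactly when none of its neighbours has been chosen,
-- which preserves both independence and maximality.
maximal-independent :
  ∀ n (H : Fin n → Fin n → Set) → (∀ c c′ → Dec (H c c′)) → (∀ {c c′} → H c c′ → H c′ c) → (∀ {c} → ¬ H c c) →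
  Σ (Fin n → Bool) λ I →
    (∀ c c′ → H c c′ → I c ≡ true → I c′ ≡ false) ×
    (∀ c → I c ≡ false → ∃ λ c′ → H c c′ × I c′ ≡ true)
maximal-independent zero H H? H-sym H-irr = (λ ()) , (λ ()) , (λ ())
maximal-independent (suc n) H H? H-sym H-irr
  with maximal-independent n (λ c c′ → H (suc c) (suc c′)) (λ c c′ → H? (suc c) (suc c′)) H-sym H-irr
... | I , ind , max with any? (λ c → H? zero (suc c) ×-dec (I c 𝔹.≟ true))
...   | yes (c₀ , h₀ , I₀) = J , ind′ , max′
  where
  J : Fin (suc n) → Bool
  J zero    = false
  J (suc c) = I c
  ind′ : ∀ c c′ → H c c′ → J c ≡ true → J c′ ≡ false
  ind′ (suc c) zero     h Jc = refl
  ind′ (suc c) (suc c′) h Jc = ind c c′ h Jc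
  max′ : ∀ c → J c ≡ false → ∃ λ c′ → H c c′ × J c′ ≡ true
  max′ zero    _  = suc c₀ , h₀ , I₀
  max′ (suc c) Jc with c′ , h , I′ ← max c Jc = suc c′ , h , I′
...   | no none = J , ind′ , max′
  where
  J : Fin (suc n) → Bool
  J zero    = true
  J (suc c) = I c
  ind′ : ∀ c c′ → H c c′ → J c ≡ true → J c′ ≡ false
  ind′ zero    zero     h Jc = contradiction h H-irr
  ind′ zero    (suc c′) h Jc = 𝔹.¬-not λ I′ → none (c′ , h , I′)
  ind′ (suc c) zero     h Jc = contradiction (c , H-sym h , Jc) none
  ind′ (suc c) (suc c′) h Jc = ind c c′ h Jc
  max′ : ∀ c → J c ≡ false → ∃ λ c′ → H c c′ × J c′ ≡ true
  max′ (suc c) Jc with c′ , h , I′ ← max c Jc = suc c′ , h , I′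

-- A vertex of a maximal independent set has all its neighbours outside; a vertex outside has a
-- neighbour inside by maximality.
split : (H : Fin n → Fin n → Set) → (∀ c c′ → Dec (H c c′)) → (∀ {c c′} → H c c′ → H c′ c) → (∀ {c} → ¬ H c c) →
        Σ (Fin n → Bool) (Split H)
split H H? H-sym H-irr with maximal-independent _ H H? H-sym H-irr
... | I , ind , max = I , opposite
  where
  opposite : Split H I
  opposite c c′ h with I c in Ic
  ... | true  = c′ , h , λ eq → case trans eq (ind c c′ h Ic) of λ ()
  ... | false with c″ , h″ , I″ ← max c Ic = c″ , h″ , λ eq → case trans eq I″ of λ ()

-- Rainbow walks inside a vertex set

module _ {n} (G : Graph n) (D : Fin n → Set) (χ : Fin n → Fin n → ℕ) where

  -- Walks are kept inside `D` so that recolouring edges outside `D` cannot spoil them. Repeated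
  -- vertices are tolerated here and removed at the very end by `toPath`.
  data RWalk : Fin n → Fin n → List ℕ → Set where
    stop : ∀ {x} → D x → RWalk x x []
    step : ∀ {x y z cs} → D x → adj G x y ≡ true → RWalk y z cs → RWalk x z (χ x y ∷ cs)

  -- The half-open window of colours is what makes concatenation easy: two rainbow walks with
  -- disjoint windows compose to a rainbow walk.
  Rainbow : ℕ → ℕ → Fin n → Fin n → Set
  Rainbow lo hi x y = ∃ λ cs → RWalk x y cs × Unique cs × All (λ k → lo ≤ k × k < hi) cs

module _ {n} {G : Graph n} {D : Fin n → Set} {χ : Fin n → Fin n → ℕ} where

  start∈ : ∀ {x y cs} → RWalk G D χ x y cs → D x
  start∈ (stop d)     = d
  start∈ (step d _ _) = d

  rwalk-++ : ∀ {x y z cs ds} → RWalk G D χ x y cs → RWalk G D χ y z ds → RWalk G D χ x z (cs ++ ds)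
  rwalk-++ (stop _)     q = q
  rwalk-++ (step d e p) q = step d e (rwalk-++ p q)

  rwalk-rev : (∀ u v → χ u v ≡ χ v u) → ∀ {x y cs} → RWalk G D χ x y cs → RWalk G D χ y x (reverse cs)
  rwalk-rev χ-sym (stop d) = stop d
  rwalk-rev χ-sym (step {x} {y} {z} {cs} d e p) =
    subst (RWalk G D χ z x) (sym (unfold-reverse (χ x y) cs))
      (rwalk-++ (rwalk-rev χ-sym p)
        (subst (λ k → RWalk G D χ y x (k ∷ [])) (χ-sym y x)
          (step (start∈ p) (trans (adj-sym G y x) e) (stop d))))

  rainbow-[] : ∀ {lo hi x} → D x → Rainbow G D χ lo hi x x
  rainbow-[] d = [] , stop d , [] , []

  rainbow-rev : (∀ u v → χ u v ≡ χ v u) → ∀ {lo hi x y} → Rainbow G D χ lo hi x y → Rainbow G D χ lo hi y x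
  rainbow-rev χ-sym (cs , p , u , r) = reverse cs , rwalk-rev χ-sym p
    , Permutation.Unique-resp-↭ reversal u
    , Permutation.All-resp-↭ (λ { refl → id }) reversal r
    where reversal = ↭-sym (Permutation.↭-reverse cs)

  rainbow-++ : ∀ {lo hi l₁ h₁ l₂ h₂ x y z} → (h₁ ≤ l₂ ⊎ h₂ ≤ l₁) → lo ≤ l₁ → h₁ ≤ hi → lo ≤ l₂ → h₂ ≤ hi →
               Rainbow G D χ l₁ h₁ x y → Rainbow G D χ l₂ h₂ y z → Rainbow G D χ lo hi x z
  rainbow-++ sep a b c d (cs , p , u , r) (ds , q , v , s) = cs ++ ds , rwalk-++ p q
    , Unique.++⁺ u v (λ (k∈cs , k∈ds) → apart sep (All.lookup r k∈cs) (All.lookup s k∈ds))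
    , All.++⁺ (All.map (λ (l , h) → ≤-trans a l , ≤-trans h b) r) (All.map (λ (l , h) → ≤-trans c l , ≤-trans h d) s)
    where
    apart : ∀ {k l₁ h₁ l₂ h₂} → (h₁ ≤ l₂ ⊎ h₂ ≤ l₁) → (l₁ ≤ k × k < h₁) → (l₂ ≤ k × k < h₂) → ⊥
    apart (inj₁ le) (_ , k<h₁) (l₂≤k , _) = <-irrefl refl (≤-trans k<h₁ (≤-trans le l₂≤k))
    apart (inj₂ le) (l₁≤k , _) (_ , k<h₂) = <-irrefl refl (≤-trans k<h₂ (≤-trans le l₁≤k))

  rainbow-edge : ∀ {k x y} → D x → D y → adj G x y ≡ true → χ x y ≡ k → Rainbow G D χ k (suc k) x y
  rainbow-edge dx dy e refl = _ , step dx e (stop dy) , [] ∷ [] , (≤-refl , ≤-refl) ∷ []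

  rainbow-map : ∀ {D′ χ′} → (∀ {x} → D x → D′ x) → (∀ {x y} → D x → D y → χ x y ≡ χ′ x y) →
                ∀ {lo hi x y} → Rainbow G D χ lo hi x y → Rainbow G D′ χ′ lo hi x y
  rainbow-map {D′} {χ′} D⊆ agree (cs , p , u , r) = cs , go p , u , r
    where
    go : ∀ {x y cs} → RWalk G D χ x y cs → RWalk G D′ χ′ x y cs
    go (stop d)     = stop (D⊆ d)
    go (step {y = y} {z} {cs} d e p) =
      subst (λ k → RWalk G D′ χ′ _ z (k ∷ cs)) (sym (agree d (start∈ p))) (step (D⊆ d) e (go p))

-- Enlarging a dominating set

module Distance {n} (G : Graph n) (D : Fin n → Set) (D? : ∀ v → Dec (D v))
                (near : ∀ v → ∃₂ λ k y → D y × Reach G k v y) where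

  Within : ℕ → Fin n → Set
  Within k v = ∃ λ y → D y × Reach G k v y

  private
    nearest : ∀ v → ∃ λ k → Within k v × (∀ {j} → Within j v → k ≤ j)
    nearest v with k , y , w ← near v =
      least (λ k → any? λ y → D? y ×-dec reach? G k v y) {k} (y , w)

  opaque
    d : Fin n → ℕ
    d v = proj₁ (nearest v)

    d-attained : ∀ v → Within (d v) v
    d-attained v = proj₁ (proj₂ (nearest v))

    d-min : ∀ {k v} → Within k v → d v ≤ k
    d-min {v = v} = proj₂ (proj₂ (nearest v))

  D⇒d≡0 : ∀ {v} → D v → d v ≡ 0
  D⇒d≡0 dv = n≤0⇒n≡0 (d-min (_ , dv , [] , refl))

  d≡0⇒D : ∀ {v} → d v ≡ 0 → D v
  d≡0⇒D {v} eq with d v | d-attained v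
  d≡0⇒D refl | .0 | _ , dy , [] , refl = dy

  1≤d⇒¬D : ∀ {v} → 1 ≤ d v → ¬ D v
  1≤d⇒¬D 1≤ dv with () ← subst (1 ≤_) (D⇒d≡0 dv) 1≤

  ¬D⇒1≤d : ∀ {v} → ¬ D v → 1 ≤ d v
  ¬D⇒1≤d ¬dv = n≢0⇒n>0 λ eq → ¬dv (d≡0⇒D eq)

  d-lipschitz : ∀ {u v} → adj G u v ≡ true → d u ≤ suc (d v)
  d-lipschitz {v = v} e with y , dy , w ← d-attained v = d-min (y , dy , reach-++ (reach-edge e) w)

  private
    Parent : Fin n → Fin n → Set
    Parent v u = 1 ≤ d v → adj G v u ≡ true × suc (d u) ≡ d v

    parent : ∀ v → ∃ (Parent v)
    parent v with d-attained v
    -- A vertex of `D` has no parent; `v` itself is a default value, excluded by the hypothesis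
    -- `1 ≤ d v`.
    ... | _ , dy , [] , eq = v , λ 1≤ → contradiction dy (1≤d⇒¬D 1≤)
    ... | _ , dy , _∷_ {y = u} e p , eq = u , λ _ → e ,
      ≤-antisym (subst (suc (d u) ≤_) eq (s≤s (d-min (_ , dy , p , refl)))) (d-lipschitz e)

  opaque
    par : Fin n → Fin n
    par v = proj₁ (parent v)

    par-adj : ∀ {v} → 1 ≤ d v → adj G v (par v) ≡ true
    par-adj {v} 1≤ = proj₁ (proj₂ (parent v) 1≤)

    par-d : ∀ {v} → 1 ≤ d v → suc (d (par v)) ≡ d v
    par-d {v} 1≤ = proj₂ (proj₂ (parent v) 1≤)

  -- Induction along the tree path of `v`, which bottoms out at the neighbour of `D` rather than in
  -- `D`.
  climb : (P : Fin n → Set) → (∀ v → d v ≡ 1 → P v) →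
          (∀ v → 1 ≤ d (par v) → suc (d (par v)) ≡ d v → adj G v (par v) ≡ true → P (par v) → P v) →
          ∀ v → 1 ≤ d v → P v
  climb P base next v 1≤ = go _ v refl 1≤
    where
    go : ∀ k v → d v ≡ k → 1 ≤ k → P v
    go (suc zero)    v eq _ = base v eq
    go (suc (suc k)) v eq _ = next v (subst (1 ≤_) (sym d-par) (s≤s z≤n)) (par-d 1≤d) (par-adj 1≤d)
                                (go (suc k) (par v) d-par (s≤s z≤n))
      where
      1≤d : 1 ≤ d v
      1≤d = subst (1 ≤_) (sym eq) (s≤s z≤n)
      d-par : d (par v) ≡ suc k
      d-par = suc-injective (trans (par-d 1≤d) eq)

  private
    -- The first argument is the distance of the vertex to `D`. Stopping at one as well as at zero
    -- ends the ascent just before `D`.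
    ancestor : ℕ → Fin n → Fin n
    ancestor zero          v = v
    ancestor (suc zero)    v = v
    ancestor (suc (suc k)) v = ancestor (suc k) (par v)

  -- The ancestor of v next to D; it names the branch of the breadth-first forest that contains v.
  root : Fin n → Fin n
  root v = ancestor (d v) v

  root-self : ∀ {v} → d v ≡ 1 → root v ≡ v
  root-self {v} eq = cong (λ k → ancestor k v) eq

  root-par : ∀ {v} → 1 ≤ d (par v) → suc (d (par v)) ≡ d v → root v ≡ root (par v)
  root-par {v} 1≤ eq with d (par v) | d v
  root-par {v} 1≤ refl | suc k | .(suc (suc k)) = refl

  d-root : ∀ v → 1 ≤ d v → d (root v) ≡ 1
  d-root = climb _ (λ v eq → trans (cong d (root-self eq)) eq)
    (λ v 1≤ eq _ ih → trans (cong d (root-par 1≤ eq)) ih)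

  reach-root : ∀ v → 1 ≤ d v → Reach G (pred (d v)) v (root v)
  reach-root = climb _
    (λ v eq → subst₂ (λ k w → Reach G k v w) (sym (cong pred eq)) (sym (root-self eq)) ([] , refl))
    (λ v 1≤ eq e ih → subst₂ (λ k w → Reach G k v w)
      (trans (suc-pred (d (par v)) {{>-nonZero 1≤}}) (cong pred eq)) (sym (root-par 1≤ eq))
      (reach-++ (reach-edge e) ih))

module Extend {n} (G : Graph n) (D : Fin n → Set) (D? : ∀ v → Dec (D v)) (k ζ : ℕ) (3≤ζ : 3 ≤ ζ)
              (short : ∀ {a b} → adj G a b ≡ true → Σ (Walk (deleteEdge G a b) b a) λ p → length p < ζ)
              (near : ∀ v → ∃ λ y → D y × ∃ λ j → Reach G j v y × j ≤ suc k)
              (χ : Fin n → Fin n → ℕ) (χ-sym : ∀ u v → χ u v ≡ χ v u) (B : ℕ)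
              (χ-rainbow : ∀ {x y} → D x → D y → Rainbow G D χ 0 B x y) where

  private
    nearby : ∀ v → ∃₂ λ j y → D y × Reach G j v y
    nearby v = let y , dy , j , w , _ = near v in j , y , dy , w

  open Distance G D D? nearby

  N : ℕ
  N = (2 * suc k + 1) ⊓ ζ

  3≤N : 3 ≤ N
  3≤N = ⊓-glb (≤-trans (m≤n+m 3 (2 * k)) (≤-reflexive (lemma k))) 3≤ζ
    where
    open +-*-Solver
    lemma : ∀ k → 2 * k + 3 ≡ 2 * suc k + 1
    lemma = solve 1 (λ k → con 2 :* k :+ con 3 := con 2 :* (con 1 :+ k) :+ con 1) refl

  d≤ : ∀ v → d v ≤ suc k
  d≤ v with y , dy , j , w , j≤ ← near v = ≤-trans (d-min (y , dy , w)) j≤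

  -- The inequality on distances says that the level `d u` on a low branch stays strictly below the
  -- level `N ∸ d v` on a high one.
  Cross : Fin n → Fin n → Set
  Cross u v = adj G u v ≡ true × 1 ≤ d u × 1 ≤ d v × root u ≢ root v × d u + d v < N

  cross-sym : ∀ {u v} → Cross u v → Cross v u
  cross-sym {u} {v} (e , 1≤u , 1≤v , r , s) =
    trans (adj-sym G v u) e , 1≤v , 1≤u , r ∘ sym , subst (_< N) (+-comm (d u) (d v)) s

  SecondExit : Fin n → Set
  SecondExit c = d c ≡ 1 × ∃ λ y → D y × adj G c y ≡ true × y ≢ par c

  -- The tree edge at `c` lies on a short cycle. Followed from `c`, this cycle ends in `D`, so it
  -- must leave the branch of `c`; its first departure is the required edge.
  leave-branch : ∀ {c} → d c ≡ 1 → SecondExit c ⊎ ∃₂ λ u v → root u ≡ c × Cross u v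
  leave-branch {c} dc≡1 with q , q< ←
      short {par c} {c} (trans (adj-sym G (par c) c) (par-adj (≤-reflexive (sym dc≡1)))) =
    go 0 (root-self dc≡1) 1≤dc (≤-reflexive dc≡1) q q<
    where
    1≤dc : 1 ≤ d c
    1≤dc = ≤-reflexive (sym dc≡1)
    D-par : D (par c)
    D-par = d≡0⇒D (suc-injective (trans (par-d 1≤dc) dc≡1))
    -- `s` counts the steps taken inside the branch. At a departure along `u v`, `d u` is at most
    -- `suc s` and `d v` at most the length still ahead, so their sum is below `ζ`; `d≤` gives the
    -- other term of `N`.
    go : ∀ {u} s → root u ≡ c → 1 ≤ d u → d u ≤ suc s →
         (q : Walk (deleteEdge G (par c) c) u (par c)) → s + length q < ζ →
         SecondExit c ⊎ ∃₂ λ u v → root u ≡ c × Cross u v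
    go s ru 1≤u u≤ [] q< = contradiction D-par (1≤d⇒¬D 1≤u)
    go {u} s ru 1≤u u≤ (_∷_ {y = v} e q) q< with delete-edge⁻ G e | D? v | root v ≟ c
    -- A branch vertex adjacent to `D` is the root `c` itself, and the edge taken is not the deleted
    -- one, so it ends away from `par c`.
    ... | e , ≢e | yes dv | _ = inj₁ (dc≡1 , v , dv , subst (λ w → adj G w v ≡ true) u≡c e ,
            λ v≡ → ≢e (inj₂ (u≡c , v≡)))
      where
      u≡c : u ≡ c
      u≡c = trans (sym (root-self (≤-antisym (subst (λ m → d u ≤ suc m) (D⇒d≡0 dv) (d-lipschitz e)) 1≤u))) ru
    ... | e , _ | no ¬dv | yes rv = go (suc s) rv (¬D⇒1≤d ¬dv)
            (≤-trans (d-lipschitz (trans (adj-sym G v u) e)) (s≤s u≤)) q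
            (subst (_< ζ) (+-suc s (length q)) q<)
    ... | e , _ | no ¬dv | no rv≢ = inj₂ (u , v , ru , e , 1≤u , ¬D⇒1≤d ¬dv , (λ eq → rv≢ (trans (sym eq) ru)) ,
            ⊓-glb (≤-trans (s≤s (+-mono-≤ (d≤ u) (d≤ v))) (≤-reflexive (lemma k)))
                  (≤-trans (s≤s (≤-trans (+-mono-≤ u≤ v≤) (≤-reflexive (sym (+-suc s (length q)))))) q<))
      where
      v≤ : d v ≤ length q
      v≤ = d-min (par c , D-par , reach-undelete G (q , refl))
      open +-*-Solver
      lemma : ∀ k → suc (suc k + suc k) ≡ 2 * suc k + 1
      lemma = solve 1 (λ k → con 2 :+ k :+ (con 1 :+ k) := con 2 :* (con 1 :+ k) :+ con 1) refl

  cross? : ∀ u v → Dec (Cross u v)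
  cross? u v = (adj G u v 𝔹.≟ true) ×-dec (1 ≤? d u) ×-dec (1 ≤? d v) ×-dec ¬? (root u ≟ root v) ×-dec (_ <? N)

  H : Fin n → Fin n → Set
  H c c′ = ∃₂ λ u v → Cross u v × root u ≡ c × root v ≡ c′

  opaque
    sides : Σ (Fin n → Bool) (Split H)
    sides = split H
      (λ c c′ → any? λ u → any? λ v → cross? u v ×-dec (root u ≟ c) ×-dec (root v ≟ c′))
      (λ (u , v , uv , ru , rv) → v , u , cross-sym uv , rv , ru)
      (λ (u , v , (_ , _ , _ , ≢r , _) , ru , rv) → ≢r (trans ru (sym rv)))

  low : Fin n → Bool
  low v = proj₁ sides (root v)

  low-par : ∀ {v} → 1 ≤ d (par v) → suc (d (par v)) ≡ d v → low v ≡ low (par v)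
  low-par 1≤ eq = cong (proj₁ sides) (root-par 1≤ eq)

  OppositeCross : Fin n → Set
  OppositeCross u = ∃ λ v → Cross u v × low u ≢ low v

  Good : Fin n → Set
  Good u = OppositeCross u ⊎ SecondExit u

  good? : ∀ u → Dec (Good u)
  good? u = (any? λ v → cross? u v ×-dec ¬? (low u 𝔹.≟ low v)) ⊎-dec
            ((d u ≟ℕ 1) ×-dec any? λ y → D? y ×-dec (adj G u y 𝔹.≟ true) ×-dec ¬? (y ≟ par u))

  -- The vertices to be added are those on tree paths from good vertices. Each has two ways into
  -- `D`: along the tree, or back to the good vertex and out through its extra edge.
  data S : Fin n → Set where
    good : ∀ {v} → Good v → S v
    up   : ∀ {v} → S v → 1 ≤ d (par v) → suc (d (par v)) ≡ d v → S (par v)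

  S⇒1≤d : ∀ {v} → S v → 1 ≤ d v
  S⇒1≤d (good (inj₁ (_ , (_ , 1≤ , _) , _))) = 1≤
  S⇒1≤d (good (inj₂ (eq , _)))               = ≤-reflexive (sym eq)
  S⇒1≤d (up _ 1≤ _)                          = 1≤

  S⇒d<N : ∀ {v} → S v → d v < N
  S⇒d<N (good (inj₁ (_ , (_ , _ , _ , _ , s) , _))) = ≤-trans (s≤s (m≤m+n _ _)) s
  S⇒d<N (good (inj₂ (eq , _)))                      = subst (_< N) (sym eq) (<⇒≤ 3≤N)
  S⇒d<N (up {v} s _ eq)                             = ≤-trans (≤-reflexive eq) (<⇒≤ (S⇒d<N s))

  -- A member is found from a good vertex `u` and a number of parent steps; fewer than `d u` steps
  -- suffice, because each lowers the distance by one and `D` is not entered.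
  S? : ∀ v → Dec (S v)
  S? w = map′ (λ (u , g , i , eq) → subst S eq (proj₁ (to g (toℕ i) (toℕ<n i)))) from
              (any? λ u → good? u ×-dec any? {n = d u} λ i → fold u par (toℕ i) ≟ w)
    where
    to : ∀ {u} → Good u → ∀ i → i < d u → S (fold u par i) × i + d (fold u par i) ≡ d u
    to g zero    _  = good g , refl
    to {u} g (suc i) i< with to g i (<-trans (n<1+n i) i<)
    ... | s , eq = up s 1≤ (par-d (S⇒1≤d s)) , eq′
      where
      eq′ : suc i + d (fold u par (suc i)) ≡ d u
      eq′ = trans (sym (+-suc i _)) (trans (cong (i +_) (par-d (S⇒1≤d s))) eq)
      1≤ : 1 ≤ d (fold u par (suc i))
      1≤ = n≢0⇒n>0 λ z → <-irrefl (trans (sym (+-identityʳ (suc i))) (trans (cong (suc i +_) (sym z)) eq′)) i<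
    from : ∀ {w} → S w → ∃ λ u → Good u × ∃ λ (i : Fin (d u)) → fold u par (toℕ i) ≡ w
    from s = let u , g , i , eq , s′ = raw s in
      u , g , fromℕ< (i<d s′) , trans (cong (fold u par) (toℕ-fromℕ< (i<d s′))) eq
      where
      i<d : ∀ {i v w} → i + d w ≡ d v × 1 ≤ d w → i < d v
      i<d {i} {v} {w} (eq , 1≤) = subst (suc i ≤_) eq (≤-trans (≤-reflexive (+-comm 1 i)) (+-monoʳ-≤ i 1≤))
      raw : ∀ {w} → S w → ∃ λ u → Good u × ∃ λ i → fold u par i ≡ w × (i + d w ≡ d u × 1 ≤ d w)
      raw (good {v} g) = v , g , 0 , refl , refl , S⇒1≤d (good g)
      raw (up s 1≤ eq) with u , g , i , refl , eq′ , _ ← raw s =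
        u , g , suc i , refl , trans (sym (+-suc i _)) (trans (cong (i +_) eq) eq′) , 1≤

  S-root : ∀ v → 1 ≤ d v → S v → S (root v)
  S-root = climb _ (λ v eq s → subst S (sym (root-self eq)) s)
    (λ v 1≤ eq _ ih s → subst S (sym (root-par 1≤ eq)) (ih (up s 1≤ eq)))

  -- This is what lowers the domination distance. If the branch of `c` has a crossing edge, the
  -- splitting supplies one to a branch of the opposite side, and the tree path from its end passes
  -- through `c`.
  neighbour∈S : ∀ {c} → d c ≡ 1 → S c
  neighbour∈S {c} dc with leave-branch dc
  ... | inj₁ second = good (inj₂ second)
  ... | inj₂ (u , v , ru , uv) with proj₂ sides c (root v) (u , v , uv , ru , refl)
  ...   | _ , (u′ , v′ , u′v′ , ru′ , refl) , ≢side =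
    subst S ru′ (S-root u′ (proj₁ (proj₂ u′v′)) (good (inj₁ (v′ , u′v′ ,
      subst (λ w → proj₁ sides w ≢ low v′) (sym ru′) ≢side))))

  D′ : Fin n → Set
  D′ v = D v ⊎ S v

  D′? : ∀ v → Dec (D′ v)
  D′? v = D? v ⊎-dec S? v

  near′ : ∀ v → ∃ λ y → D′ y × ∃ λ j → Reach G j v y × j ≤ k
  near′ v with D? v
  ... | yes dv = v , inj₁ dv , 0 , ([] , refl) , z≤n
  ... | no ¬dv = root v , inj₂ (neighbour∈S (d-root v 1≤d)) , pred (d v) , reach-root v 1≤d , pred-mono-≤ (d≤ v)
    where
    1≤d : 1 ≤ d v
    1≤d = ¬D⇒1≤d ¬dv

  -- A branch leaves D through its own tree edge on its own side, and through any further edge to D on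
  -- the other side; level 0 and level N both stand for D.
  level : Fin n → ℕ
  level v = if low v then d v else N ∸ d v

  portal : Fin n → Fin n → ℕ
  portal v y = if does (y ≟ par v)
    then (if low v then 0 else N ∸ 1)
    else (if low v then N ∸ 1 else 0)

  χ′ : Fin n → Fin n → ℕ
  χ′ u v with D? u | D? v
  ... | yes _ | yes _ = χ u v
  ... | yes _ | no  _ = B + portal v u
  ... | no  _ | yes _ = B + portal u v
  ... | no  _ | no  _ = B + (level u ⊓ level v)

  χ′-sym : ∀ u v → χ′ u v ≡ χ′ v u
  χ′-sym u v with D? u | D? v
  ... | yes _ | yes _ = χ-sym u v
  ... | yes _ | no  _ = refl
  ... | no  _ | yes _ = refl
  ... | no  _ | no  _ = cong (B +_) (⊓-comm (level u) (level v))

  χ′-inside : ∀ {u v} → D u → D v → χ u v ≡ χ′ u v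
  χ′-inside {u} {v} du dv with D? u | D? v
  ... | yes _  | yes _  = refl
  ... | no ¬du | _      = contradiction du ¬du
  ... | yes _  | no ¬dv = contradiction dv ¬dv

  χ′-portal : ∀ {v y} → 1 ≤ d v → D y → χ′ v y ≡ B + portal v y
  χ′-portal {v} {y} 1≤ dy with D? v | D? y
  ... | yes dv | _      = contradiction dv (1≤d⇒¬D 1≤)
  ... | no  _  | yes _  = refl
  ... | no  _  | no ¬dy = contradiction dy ¬dy

  χ′-outside : ∀ {u v} → 1 ≤ d u → 1 ≤ d v → χ′ u v ≡ B + (level u ⊓ level v)
  χ′-outside {u} {v} 1≤u 1≤v with D? u | D? v
  ... | yes du | _      = contradiction du (1≤d⇒¬D 1≤u)
  ... | no  _  | yes dv = contradiction dv (1≤d⇒¬D 1≤v)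
  ... | no  _  | no  _  = refl

  level-low : ∀ {v} → low v ≡ true → level v ≡ d v
  level-low eq rewrite eq = refl

  level-high : ∀ {v} → low v ≡ false → level v ≡ N ∸ d v
  level-high eq rewrite eq = refl

  portal-own : ∀ v → portal v (par v) ≡ (if low v then 0 else N ∸ 1)
  portal-own v with par v ≟ par v
  ... | yes _ = refl
  ... | no ≢  = contradiction refl ≢

  portal-other : ∀ {v y} → y ≢ par v → portal v y ≡ (if low v then N ∸ 1 else 0)
  portal-other {v} {y} y≢ with y ≟ par v
  ... | yes y≡ = contradiction y≡ y≢
  ... | no _   = refl

  Exit : ℕ → ℕ → Fin n → Set
  Exit lo hi v = ∃ λ y → D y × Rainbow G D′ χ′ (B + lo) (B + hi) v y

  edge-colour : ∀ {m v u} → D′ v → D′ u → adj G v u ≡ true → χ′ v u ≡ B + m →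
                Rainbow G D′ χ′ (B + m) (B + suc m) v u
  edge-colour {m} {v} {u} dv du e eq = subst (λ h → Rainbow G D′ χ′ (B + m) h v u) (sym (+-suc B m))
    (rainbow-edge dv du e eq)

  exit-now : ∀ {lo hi m v y} → D′ v → D y → adj G v y ≡ true → χ′ v y ≡ B + m → lo ≤ m → m < hi → Exit lo hi v
  exit-now dv dy e eq lo≤ <hi = _ , dy , rainbow-++ (inj₁ ≤-refl) B≤ B< (≤-trans B≤ (+-monoʳ-≤ B (n≤1+n _))) B<
    (edge-colour dv (inj₁ dy) e eq) (rainbow-[] (inj₁ dy))
    where
    B≤ = +-monoʳ-≤ B lo≤
    B< = +-monoʳ-≤ B <hi

  exit-below : ∀ {lo hi m v u} → D′ v → S u → adj G v u ≡ true → χ′ v u ≡ B + m → m < lo → m < hi →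
               Exit lo hi u → Exit m hi v
  exit-below dv su e eq m<lo m<hi (y , dy , p) = y , dy ,
    rainbow-++ (inj₁ (+-monoʳ-≤ B m<lo)) ≤-refl (+-monoʳ-≤ B m<hi) (+-monoʳ-≤ B (<⇒≤ m<lo)) ≤-refl
      (edge-colour dv (inj₂ su) e eq) p

  exit-above : ∀ {lo hi m v u} → D′ v → S u → adj G v u ≡ true → χ′ v u ≡ B + m → hi ≤ m → lo ≤ m →
               Exit lo hi u → Exit lo (suc m) v
  exit-above dv su e eq hi≤m lo≤m (y , dy , p) = y , dy ,
    rainbow-++ (inj₂ (+-monoʳ-≤ B hi≤m)) (+-monoʳ-≤ B lo≤m) ≤-refl ≤-refl (+-monoʳ-≤ B (m≤n⇒m≤1+n hi≤m))
      (edge-colour dv (inj₂ su) e eq) p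

  exit-widen : ∀ {lo lo′ hi hi′ v} → lo′ ≤ lo → hi ≤ hi′ → Exit lo hi v → Exit lo′ hi′ v
  exit-widen lo≤ hi≤ (y , dy , cs , p , u , r) = y , dy , cs , p , u ,
    All.map (λ (l , h) → ≤-trans (+-monoʳ-≤ B lo≤) l , ≤-trans h (+-monoʳ-≤ B hi≤)) r

  par∈D : ∀ {v} → d v ≡ 1 → D (par v)
  par∈D eq = d≡0⇒D (suc-injective (trans (par-d (≤-reflexive (sym eq))) eq))

  -- The colours met on the way to `D`, relative to `B`, are `d v` - 1, ..., 1, 0.
  tree-low : ∀ v → 1 ≤ d v → S v → low v ≡ true → Exit 0 (d v) v
  tree-low = climb _
    (λ v eq s lv → subst (λ h → Exit 0 h v) (sym eq)
      (exit-now {m = 0} (inj₂ s) (par∈D eq) (par-adj (S⇒1≤d s))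
        (trans (χ′-portal (S⇒1≤d s) (par∈D eq))
          (cong (B +_) (trans (portal-own v) (cong (if_then 0 else (N ∸ 1)) lv)))) z≤n (s≤s z≤n)))
    (λ v 1≤ eq e ih s lv →
      let lp = trans (sym (low-par 1≤ eq)) lv in
      subst (λ h → Exit 0 h v) eq
        (exit-above (inj₂ s) (up s 1≤ eq) e
          (trans (χ′-outside (S⇒1≤d s) 1≤) (cong (B +_) (trans (cong₂ _⊓_ (level-low lv) (level-low lp))
            (m≥n⇒m⊓n≡n (≤-trans (n≤1+n _) (≤-reflexive eq)))))) ≤-refl z≤n (ih (up s 1≤ eq) lp)))

  1+[N∸1+m] : ∀ {m} → suc m ≤ N → suc (N ∸ suc m) ≡ N ∸ m
  1+[N∸1+m] {m} h = sym (+-∸-assoc 1 h)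

  -- Here the colours increase on the way to `D`: `N ∸ d v`, ..., `N ∸ 1`, relative to `B`.
  tree-high : ∀ v → 1 ≤ d v → S v → low v ≡ false → Exit (N ∸ d v) N v
  tree-high = climb _
    (λ v eq s lv → subst (λ l → Exit (N ∸ l) N v) (sym eq)
      (exit-now {m = N ∸ 1} (inj₂ s) (par∈D eq) (par-adj (S⇒1≤d s))
        (trans (χ′-portal (S⇒1≤d s) (par∈D eq))
          (cong (B +_) (trans (portal-own v) (cong (if_then 0 else (N ∸ 1)) lv)))) ≤-refl
        (≤-reflexive (1+[N∸1+m] (<⇒≤ (<⇒≤ 3≤N))))))
    (λ v 1≤ eq e ih s lv →
      let lp = trans (sym (low-par 1≤ eq)) lv
          m<lo : N ∸ d v < N ∸ d (par v)
          m<lo = ≤-reflexive (trans (cong (λ t → suc (N ∸ t)) (sym eq))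
                   (1+[N∸1+m] (≤-trans (≤-reflexive eq) (<⇒≤ (S⇒d<N s)))))
      in exit-below (inj₂ s) (up s 1≤ eq) e
          (trans (χ′-outside (S⇒1≤d s) 1≤) (cong (B +_) (trans (cong₂ _⊓_ (level-high lv) (level-high lp))
            (m≤n⇒m⊓n≡m (<⇒≤ m<lo))))) m<lo (≤-trans m<lo (m∸n≤m N (d (par v)))) (ih (up s 1≤ eq) lp))

  <⇒gap : ∀ u v → d u + d v < N → d u < N ∸ d v
  <⇒gap u v h = m+n≤o⇒m≤o∸n (suc (d u)) h

  -- Moving away from `D` to the good vertex, the colours rise from `d v`. There either the crossing
  -- edge takes the level of its low end, below all colours of the high tree path that follows, or
  -- the second exit has colour `N ∸ 1`.
  escape-low : ∀ {v} → S v → low v ≡ true → Exit (d v) N v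
  escape-low {u} s@(good (inj₁ (v , uv@(e , 1≤u , 1≤v , _ , sum) , side))) lu =
    exit-below (inj₂ s) sv e
      (trans (χ′-outside 1≤u 1≤v) (cong (B +_) (trans (cong₂ _⊓_ (level-low lu) (level-high lv))
        (m≤n⇒m⊓n≡m (<⇒≤ gap))))) gap (S⇒d<N s) (tree-high v 1≤v sv lv)
    where
    gap = <⇒gap u v sum
    lv : low v ≡ false
    lv = 𝔹.¬-not λ eq → side (trans lu (sym eq))
    sv : S v
    sv = good (inj₁ (u , cross-sym uv , side ∘ sym))
  escape-low s@(good (inj₂ (eq , y , dy , e , y≢))) lu =
    exit-now (inj₂ s) dy e
      (trans (χ′-portal (S⇒1≤d s) dy) (cong (B +_) (trans (portal-other y≢) (cong (if_then (N ∸ 1) else 0) lu))))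
      (≤-trans (≤-reflexive eq) (∸-monoˡ-≤ 1 (<⇒≤ 3≤N))) (≤-reflexive (1+[N∸1+m] (<⇒≤ (<⇒≤ 3≤N))))
  escape-low (up {u} s 1≤ eq) lp =
    exit-below (inj₂ (up s 1≤ eq)) s (trans (adj-sym G (par u) u) (par-adj (S⇒1≤d s)))
      (trans (χ′-outside 1≤ (S⇒1≤d s)) (cong (B +_) (trans (cong₂ _⊓_ (level-low lp) (level-low lu))
        (m≤n⇒m⊓n≡m (<⇒≤ (≤-reflexive eq))))))
      (≤-reflexive eq) (S⇒d<N (up s 1≤ eq)) (escape-low s lu)
    where
    lu = trans (low-par 1≤ eq) lp

  -- The mirror image: colours fall from just below `N ∸ d v`, and the crossing edge, at the level
  -- of its low end, exceeds all colours of the low tree path after it; a second exit has colour 0.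
  escape-high : ∀ {v} → S v → low v ≡ false → Exit 0 (N ∸ d v) v
  escape-high {u} s@(good (inj₁ (v , uv@(e , 1≤u , 1≤v , _ , sum) , side))) lu =
    exit-widen z≤n gap
      (exit-above (inj₂ s) sv e
        (trans (χ′-outside 1≤u 1≤v) (cong (B +_) (trans (cong₂ _⊓_ (level-high lu) (level-low lv))
          (m≥n⇒m⊓n≡n (<⇒≤ gap))))) ≤-refl z≤n (tree-low v 1≤v sv lv))
    where
    gap : d v < N ∸ d u
    gap = <⇒gap v u (subst (_< N) (+-comm (d u) (d v)) sum)
    lv : low v ≡ true
    lv = 𝔹.¬-not (λ eq → side (trans lu (sym eq)))
    sv : S v
    sv = good (inj₁ (u , cross-sym uv , side ∘ sym))
  escape-high s@(good (inj₂ (eq , y , dy , e , y≢))) lu =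
    exit-now {m = 0} (inj₂ s) dy e
      (trans (χ′-portal (S⇒1≤d s) dy) (cong (B +_) (trans (portal-other y≢) (cong (if_then (N ∸ 1) else 0) lu))))
      z≤n (m<n⇒0<n∸m (S⇒d<N s))
  escape-high (up {u} s 1≤ eq) lp =
    subst (λ h → Exit 0 h (par u)) lo≡
      (exit-above (inj₂ (up s 1≤ eq)) s (trans (adj-sym G (par u) u) (par-adj (S⇒1≤d s)))
        (trans (χ′-outside 1≤ (S⇒1≤d s)) (cong (B +_) (trans (cong₂ _⊓_ (level-high lp) (level-high lu))
          (m≥n⇒m⊓n≡n (≤-trans (n≤1+n _) (≤-reflexive lo≡)))))) ≤-refl z≤n (escape-high s lu))
    where
    lu = trans (low-par 1≤ eq) lp
    lo≡ : suc (N ∸ d u) ≡ N ∸ d (par u)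
    lo≡ = trans (cong (λ t → suc (N ∸ t)) (sym eq)) (1+[N∸1+m] (≤-trans (≤-reflexive eq) (<⇒≤ (S⇒d<N s))))

  exits : ∀ {v} → S v → Exit 0 (level v) v × Exit (level v) N v
  exits {v} s with low v in lv
  ... | true  = tree-low v (S⇒1≤d s) s lv , escape-low s lv
  ... | false = escape-high s lv , tree-high v (S⇒1≤d s) s lv

  level≤N : ∀ {v} → S v → level v ≤ N
  level≤N {v} s with low v
  ... | true  = <⇒≤ (S⇒d<N s)
  ... | false = m∸n≤m N (d v)

  inside : ∀ {x y} → D x → D y → Rainbow G D′ χ′ 0 B x y
  inside dx dy = rainbow-map inj₁ χ′-inside (χ-rainbow dx dy)

  from-low : ∀ {x y} → S x → D y → Rainbow G D′ χ′ 0 (B + level x) x y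
  from-low {x} sx dy with (z , dz , p) , _ ← exits sx =
    rainbow-++ (inj₂ (≤-reflexive (sym (+-identityʳ B)))) z≤n ≤-refl z≤n (m≤m+n B (level x)) p (inside dz dy)

  χ′-rainbow : ∀ {x y} → D′ x → D′ y → Rainbow G D′ χ′ 0 (B + N) x y
  χ′-rainbow (inj₁ dx) (inj₁ dy) =
    -- Appending the empty walk, whose window is empty, serves to widen the window.
    rainbow-++ (inj₂ z≤n) z≤n (m≤m+n B N) z≤n z≤n (inside dx dy) (rainbow-[] {lo = 0} {0} (inj₁ dy))
  χ′-rainbow (inj₂ sx) (inj₁ dy) =
    rainbow-++ (inj₂ z≤n) z≤n (+-monoʳ-≤ B (level≤N sx)) z≤n z≤n (from-low sx dy) (rainbow-[] {lo = 0} {0} (inj₁ dy))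
  χ′-rainbow (inj₁ dx) (inj₂ sy) = rainbow-rev χ′-sym (χ′-rainbow (inj₂ sy) (inj₁ dx))
  χ′-rainbow {x} {y} (inj₂ sx) (inj₂ sy) =
    [ (λ le → ordered sx sy le) , (λ le → rainbow-rev χ′-sym (ordered sy sx le)) ]′ (≤-total (level x) (level y))
    where
    ordered : ∀ {x y} → S x → S y → level x ≤ level y → Rainbow G D′ χ′ 0 (B + N) x y
    ordered {x} {y} sx sy le with _ , z , dz , q ← exits sy =
      rainbow-++ (inj₁ (+-monoʳ-≤ B le)) z≤n (+-monoʳ-≤ B (level≤N sx)) z≤n ≤-refl
        (from-low sx dz) (rainbow-rev χ′-sym q)

-- Iterating the enlargement: the upper bound

bound≤ : ∀ ζ r → bound ζ r ≤ r * ζ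
bound≤ ζ zero    = z≤n
bound≤ ζ (suc r) = ≤-trans (+-mono-≤ (bound≤ ζ r) (m⊓n≤n (2 * suc r + 1) ζ)) (≤-reflexive (+-comm (r * ζ) ζ))

module _ {n} (G : Graph n) where

  record Stage (k B : ℕ) : Set₁ where
    field
      D         : Fin n → Set
      D?        : ∀ v → Dec (D v)
      near      : ∀ v → ∃ λ y → D y × ∃ λ j → Reach G j v y × j ≤ k
      χ         : Fin n → Fin n → ℕ
      χ-sym     : ∀ u v → χ u v ≡ χ v u
      χ-rainbow : ∀ {x y} → D x → D y → Rainbow G D χ 0 B x y

  initial : ∀ {v r} → (∀ x → DistLE G v x r) → Stage r 0
  initial {v} within = record
    { D         = _≡ v
    ; D?        = _≟ v
    ; near      = λ x → let p , p≤ = within x in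
                    v , refl , length p , reach-rev (p , refl) , p≤
    ; χ         = λ _ _ → 0
    ; χ-sym     = λ _ _ → refl
    ; χ-rainbow = λ { refl refl → rainbow-[] refl }
    }

  module _ {ζ} (3≤ζ : 3 ≤ ζ)
           (short : ∀ {a b} → adj G a b ≡ true → Σ (Walk (deleteEdge G a b) b a) λ p → length p < ζ) where

    extend : ∀ {k B} → Stage (suc k) B → Stage k (B + (2 * suc k + 1) ⊓ ζ)
    extend {k} {B} s = record
      { D = E.D′ ; D? = E.D′? ; near = E.near′ ; χ = E.χ′ ; χ-sym = E.χ′-sym ; χ-rainbow = E.χ′-rainbow }
      where
      open Stage s
      module E = Extend G D D? k ζ 3≤ζ short near χ χ-sym B χ-rainbow

    extend-all : ∀ k {B} → Stage k B → Stage 0 (B + bound ζ k)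
    extend-all zero    {B} s = subst (Stage 0) (sym (+-identityʳ B)) s
    extend-all (suc k) {B} s = subst (Stage 0) eq (extend-all k (extend s))
      where
      N = (2 * suc k + 1) ⊓ ζ
      eq : B + N + bound ζ k ≡ B + (bound ζ k + N)
      eq = trans (+-assoc B N (bound ζ k)) (cong (B +_) (+-comm N (bound ζ k)))

  module _ {K} (c : Fin n → Fin n → Fin K) where

    suffix : ∀ {x y z} (p : Walk G y z) → x ∈ vertices p → Σ (Walk G x z) λ q →
             (IsPath p → IsPath q) × (Unique (colours c p) → Unique (colours c q)) ×
             (∀ {P : Fin K → Set} → All P (colours c p) → All P (colours c q))
    suffix []      (here refl) = [] , id , id , id
    suffix (e ∷ p) (here refl) = e ∷ p , id , id , id
    suffix (e ∷ p) (there x∈) with q , path , uniq , all ← suffix p x∈ =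
      q , (λ { (_ ∷ u) → path u }) , (λ { (_ ∷ u) → uniq u }) , (λ { (_ ∷ a) → all a })

    -- If the first vertex recurs, the walk restarts at the recurrence. Every predicate true of all
    -- old colours stays true of the new ones; this carries the freshness of the first colour
    -- through the recursion.
    toPath : ∀ {x y} (p : Walk G x y) → Unique (colours c p) → Σ (Walk G x y) λ q →
             IsPath q × Unique (colours c q) × (∀ {P : Fin K → Set} → All P (colours c p) → All P (colours c q))
    toPath [] u = [] , [] ∷ [] , u , id
    toPath (_∷_ {x} e p) (fresh ∷ u) with toPath p u
    ... | q , path , uniq , all with DecMembership._∈?_ _≟_ x (vertices q)
    ...   | yes x∈ with r , path′ , uniq′ , all′ ← suffix q x∈ =
            r , path′ path , uniq′ uniq , λ { (_ ∷ a) → all′ (all a) }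
    ...   | no x∉ = e ∷ q , All.¬Any⇒All¬ _ x∉ ∷ path , all fresh ∷ uniq , λ { (a ∷ as) → a ∷ all as }

  module _ {B} (s : Stage 0 (suc B)) where
    open Stage s

    everywhere : ∀ v → D v
    everywhere v with near v
    ... | _ , dy , _ , ([] , _) , _ = dy
    ... | _ , _ , _ , (_ ∷ _ , refl) , ()

    -- Only colours met on the rainbow walks are known to be in range, and those are left unchanged;
    -- any larger value becomes `B`.
    clamp : ℕ → Fin (suc B)
    clamp k = fromℕ< (s≤s (m⊓n≤n k B))

    clamp-< : ∀ {k} → k < suc B → toℕ (clamp k) ≡ k
    clamp-< {k} (s≤s k≤B) = trans (toℕ-fromℕ< _) (m≤n⇒m⊓n≡m k≤B)

    walk : ∀ {x y cs} → RWalk G D χ x y cs → All (λ k → 0 ≤ k × k < suc B) cs →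
           Σ (Walk G x y) λ p → map toℕ (colours (λ u v → clamp (χ u v)) p) ≡ cs
    walk (stop _)     []              = [] , refl
    walk (step _ e p) ((_ , k<) ∷ ks) with q , eq ← walk p ks = e ∷ q , cong₂ _∷_ (clamp-< k<) eq

    rainbowColouring : RainbowColouring G (suc B)
    rainbowColouring = record
      { colour    = λ u v → clamp (χ u v)
      ; symmetric = λ u v → cong clamp (χ-sym u v)
      ; rainbow   = λ x y →
          let cs , p , u , r     = χ-rainbow (everywhere x) (everywhere y)
              q , eq             = walk p r
              q′ , path , uniq , _ = toPath _ q (Unique.map⁻ (subst Unique (sym eq) u))
          in q′ , path , uniq
      }

upper-bound : ∀ {r ζ} → Bridgeless G → Radius G r → Iso G ζ → RcLE G (bound ζ r)
-- Radius zero leaves a single vertex, which cannot carry a cycle.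
upper-bound {G = G} {zero} {suc (suc ζ)} _ ((v , within) , _) (cycle , _) =
  contradiction (IsoCycle.injective cycle {zero} {suc zero} (trans (centre _) (sym (centre _)))) λ ()
  where
  centre : ∀ x → x ≡ v
  centre x with within x
  ... | [] , _ = refl
upper-bound {r = zero} {suc zero} _ _ (cycle , _) with s≤s () ← IsoCycle.three≤L cycle
upper-bound {r = zero} {zero}     _ _ (cycle , _) with () ← IsoCycle.three≤L cycle
upper-bound {G = G} {suc r} {ζ} bridgeless ((v , within) , _) (cycle , longest) =
  subst (RainbowColouring G) eq (rainbowColouring G (subst (Stage G 0) (sym eq) final))
  where
  3≤ζ = IsoCycle.three≤L cycle
  final : Stage G 0 (bound ζ (suc r))
  final = extend-all G 3≤ζ (shortCycle bridgeless longest) (suc r) (initial G within)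
  -- The bound is positive, as the palette `Fin (suc B)` demands.
  eq : suc (pred (bound ζ (suc r))) ≡ bound ζ (suc r)
  eq = suc-pred _ {{>-nonZero (≤-trans (⊓-glb (m≤n+m 1 (2 * suc r)) (≤-trans (s≤s z≤n) 3≤ζ)) (m≤n+m _ (bound ζ r)))}}

-- Cuts and cycles

connected-delete : Connected G → Walk (deleteEdge G a b) a b → Connected (deleteEdge G a b)
connected-delete {G = G} {a} {b} conn p x y = go (conn x y)
  where
  go : ∀ {x y} → Walk G x y → Walk (deleteEdge G a b) x y
  go [] = []
  go (_∷_ {x} {y} e q) with sameEdge? a b x y
  ... | yes (inj₁ (refl , refl)) = p ++ʷ go q
  ... | yes (inj₂ (refl , refl)) = revʷ p ++ʷ go q
  ... | no ≢e                    = delete-edge⁺ G e ≢e ∷ go q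

delete-swap : (G : Graph n) → Walk (deleteEdge G a b) x y → Walk (deleteEdge G b a) x y
delete-swap G []      = []
delete-swap G (e ∷ p) = let e′ , ≢e = delete-edge⁻ G e in
  delete-edge⁺ G e′ (λ { (inj₁ s) → ≢e (inj₂ s) ; (inj₂ s) → ≢e (inj₁ s) }) ∷ delete-swap G p

On : {G : Graph n} → Walk G x y → Fin n → Fin n → Set
On []                  a b = ⊥
On (_∷_ {x} {y} e p) a b = SameEdge a b x y ⊎ On p a b

module _ {K} {c : Fin n → Fin n → Fin K} (c-sym : ∀ u v → c u v ≡ c v u) where

  sameEdge-colour : SameEdge a b x y → c a b ≡ c x y
  sameEdge-colour (inj₁ (refl , refl)) = refl
  sameEdge-colour (inj₂ (refl , refl)) = c-sym _ _

  on⇒colour∈ : (p : Walk G x y) → On p a b → c a b ∈ colours c p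
  on⇒colour∈ (e ∷ p) (inj₁ same) = here (sameEdge-colour same)
  on⇒colour∈ (e ∷ p) (inj₂ on)   = there (on⇒colour∈ p on)

  on-distinct : ∀ {a b a′ b′} (p : Walk G x y) → Unique (colours c p) → On p a b → On p a′ b′ →
                c a b ≡ c a′ b′ → SameEdge a b a′ b′
  on-distinct (e ∷ p) u (inj₁ (inj₁ (refl , refl))) (inj₁ (inj₁ (refl , refl))) _ = inj₁ (refl , refl)
  on-distinct (e ∷ p) u (inj₁ (inj₁ (refl , refl))) (inj₁ (inj₂ (refl , refl))) _ = inj₂ (refl , refl)
  on-distinct (e ∷ p) u (inj₁ (inj₂ (refl , refl))) (inj₁ (inj₁ (refl , refl))) _ = inj₂ (refl , refl)
  on-distinct (e ∷ p) u (inj₁ (inj₂ (refl , refl))) (inj₁ (inj₂ (refl , refl))) _ = inj₁ (refl , refl)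
  on-distinct (e ∷ p) (fresh ∷ _) (inj₁ same) (inj₂ on) eq =
    contradiction (trans (sym (sameEdge-colour same)) eq) (All.lookup fresh (on⇒colour∈ p on))
  on-distinct (e ∷ p) (fresh ∷ _) (inj₂ on) (inj₁ same) eq =
    contradiction (trans (sym (sameEdge-colour same)) (sym eq)) (All.lookup fresh (on⇒colour∈ p on))
  on-distinct (e ∷ p) (_ ∷ u) (inj₂ on) (inj₂ on′) eq = on-distinct p u on on′ eq

module _ {G : Graph n} {X : Fin n → Set} (X? : ∀ v → Dec (X v)) where

  Crossing : Walk G x y → Set
  Crossing p = ∃₂ λ a b → adj G a b ≡ true × X a × ¬ X b × On p a b

  crossing-out : (p : Walk G x y) → X x → ¬ X y → Crossing p
  crossing-out []                   Xx ¬Xy = contradiction Xx ¬Xy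
  crossing-out (_∷_ {x} {y} e p) Xx ¬Xy with X? y
  ... | no ¬X = x , y , e , Xx , ¬X , inj₁ (inj₁ (refl , refl))
  ... | yes X with a , b , e′ , Xa , ¬Xb , on ← crossing-out p X ¬Xy = a , b , e′ , Xa , ¬Xb , inj₂ on

  crossing-in : (p : Walk G x y) → ¬ X x → X y → Crossing p
  crossing-in []                   ¬Xx Xy = contradiction Xy ¬Xx
  crossing-in (_∷_ {x} {y} e p) ¬Xx Xy with X? y
  ... | yes X = y , x , trans (adj-sym G y x) e , X , ¬Xx , inj₁ (inj₂ (refl , refl))
  ... | no ¬X with a , b , e′ , Xa , ¬Xb , on ← crossing-in p ¬X Xy = a , b , e′ , Xa , ¬Xb , inj₂ on

module _ {L} {G : Graph n} (cycle : IsoCycle G (suc L)) {U : Fin n → Set} (U? : ∀ v → Dec (U v)) {w}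
         (boundary : ∀ {u v} → adj G u v ≡ true → U u → ¬ U v → v ≡ w) where

  open IsoCycle cycle

  private
    -- Natural positions turn arcs into intervals; the reduction makes the function total and is the
    -- identity up to `L`.
    v : ℕ → Fin n
    v s = vert (s mod suc L)

    toℕ-mod : ∀ {s} → s ≤ L → toℕ (s mod suc L) ≡ s
    toℕ-mod {s} s≤L = trans (toℕ-fromℕ< (m%n<n s (suc L))) (m≤n⇒m%n≡m s≤L)

    v-vert : ∀ i → v (toℕ i) ≡ vert i
    v-vert i = cong vert (toℕ-injective (toℕ-mod (≤-pred (toℕ<n i))))

    v-injective : ∀ {s s′} → s ≤ L → s′ ≤ L → v s ≡ v s′ → s ≡ s′
    v-injective s≤ s′≤ eq = trans (sym (toℕ-mod s≤)) (trans (cong toℕ (injective eq)) (toℕ-mod s′≤))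

    1≤L : 1 ≤ L
    1≤L = ≤-trans (n≤1+n 1) (≤-pred three≤L)

    v-next : ∀ {s} → s < L → adj G (v s) (v (suc s)) ≡ true
    v-next {s} s<L = edges _ _ (trans
      (cong₂ (λ i j → ∣ i - j ∣ ⊓ (suc L ∸ ∣ i - j ∣)) (toℕ-mod (<⇒≤ s<L)) (toℕ-mod s<L))
      (trans (cong (λ k → k ⊓ (suc L ∸ k)) gap) (m≤n⇒m⊓n≡m 1≤L)))
      where
      gap : ∣ s - suc s ∣ ≡ 1
      gap = trans (m≤n⇒∣m-n∣≡n∸m (n≤1+n s)) (m+n∸n≡m 1 s)

    v-close : adj G (v 0) (v L) ≡ true
    v-close = edges _ _ (trans
      (cong₂ (λ i j → ∣ i - j ∣ ⊓ (suc L ∸ ∣ i - j ∣)) (toℕ-mod z≤n) (toℕ-mod ≤-refl))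
      (trans (m≥n⇒m⊓n≡n (≤-trans (≤-reflexive (m+n∸n≡m 1 L)) 1≤L)) (m+n∸n≡m 1 L)))

    Same : Fin n → Fin n → Set
    Same x y = (U x → U y) × (U y → U x)

    same-trans : ∀ {x y z} → Same x y → Same y z → Same x z
    same-trans (f , f′) (g , g′) = g ∘ f , f′ ∘ g′

    same-sym : ∀ {x y} → Same x y → Same y x
    same-sym (f , g) = g , f

    same-edge : ∀ {x y} → adj G x y ≡ true → x ≢ w → y ≢ w → Same x y
    same-edge {x} {y} e x≢w y≢w = stay e y≢w , stay (trans (adj-sym G y x) e) x≢w
      where
      stay : ∀ {x y} → adj G x y ≡ true → y ≢ w → U x → U y
      stay {x} {y} e y≢w Ux with U? y
      ... | yes Uy = Uy
      ... | no ¬Uy = contradiction (boundary e Ux ¬Uy) y≢w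

    same-arc : ∀ s e → s + e ≤ L → (∀ j → s ≤ j → j ≤ s + e → v j ≢ w) → Same (v s) (v (s + e))
    same-arc s zero    _  _     = subst (λ k → Same (v s) (v k)) (sym (+-identityʳ s)) (id , id)
    same-arc s (suc e) le avoid = subst (λ k → Same (v s) (v k)) (sym (+-suc s e))
      (same-trans (same-arc s e (<⇒≤ le′) (λ j s≤ j≤ → avoid j s≤ (≤-trans j≤ (<⇒≤ last))))
        (same-edge (v-next le′) (avoid _ (m≤m+n s e) (<⇒≤ last)) (avoid _ (m≤n⇒m≤1+n (m≤m+n s e)) last)))
      where
      le′ : s + e < L
      le′ = subst (_≤ L) (+-suc s e) le
      last : s + e < s + suc e
      last = ≤-reflexive (sym (+-suc s e))

    same-between : ∀ {i j} → i ≤ j → j ≤ L → (∀ k → i ≤ k → k ≤ j → v k ≢ w) → Same (v i) (v j)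
    same-between {i} {j} i≤j j≤L avoid = subst (λ k → Same (v i) (v k)) (m+[n∸m]≡n i≤j)
      (same-arc i (j ∸ i) (≤-trans (≤-reflexive (m+[n∸m]≡n i≤j)) j≤L)
        (λ k i≤ k≤ → avoid k i≤ (≤-trans k≤ (≤-reflexive (m+[n∸m]≡n i≤j)))))

    -- If w lies between i and j, it does not lie on the other arc from i to j, which passes 0 and L.
    same-≤ : ∀ {i j} → i ≤ j → j ≤ L → v i ≢ w → v j ≢ w → Same (v i) (v j)
    same-≤ {i} {j} i≤j j≤L vi≢ vj≢
      with any? {n = suc L} (λ k → (i ≤? toℕ k) ×-dec (toℕ k ≤? j) ×-dec (v (toℕ k) ≟ w))
    ... | no none = same-between i≤j j≤L λ k i≤k k≤j eq →
      let k≡ = toℕ-fromℕ< (s≤s (≤-trans k≤j j≤L)) in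
      none (fromℕ< (s≤s (≤-trans k≤j j≤L)) , subst (i ≤_) (sym k≡) i≤k , subst (_≤ j) (sym k≡) k≤j
           , trans (cong v k≡) eq)
    ... | yes (k′ , i≤k , k≤j , eq) =
      same-trans (same-sym (same-between z≤n (≤-trans i≤j j≤L) before))
        (same-trans (same-edge v-close (before 0 z≤n z≤n) (after L j≤L ≤-refl))
          (same-sym (same-between j≤L ≤-refl after)))
      where
      k≤L : toℕ k′ ≤ L
      k≤L = ≤-trans k≤j j≤L
      before : ∀ s → 0 ≤ s → s ≤ i → v s ≢ w
      before s _ s≤i eq′ = vi≢ (subst (λ s → v s ≡ w) (≤-antisym s≤i
        (subst (i ≤_) (v-injective k≤L (≤-trans s≤i (≤-trans i≤j j≤L)) (trans eq (sym eq′))) i≤k)) eq′)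
      after : ∀ s → j ≤ s → s ≤ L → v s ≢ w
      after s j≤s s≤L eq′ = vj≢ (subst (λ s → v s ≡ w) (≤-antisym
        (subst (_≤ j) (v-injective k≤L s≤L (trans eq (sym eq′))) k≤j) j≤s) eq′)

  -- `U` can be left only through `w`, and a cycle minus one vertex is still connected, so no other
  -- vertex of the cycle lies outside `U`.
  cycle-confined : ¬ U w → ∀ i j → U (vert i) → U (vert j) ⊎ vert j ≡ w
  cycle-confined ¬Uw i j Ui with vert j ≟ w
  ... | yes eq = inj₂ eq
  ... | no vj≢ = inj₁ (proj₁ same Ui)
    where
    vi≢ : vert i ≢ w
    vi≢ eq = ¬Uw (subst U eq Ui)
    lift : ∀ k → vert k ≢ w → v (toℕ k) ≢ w
    lift k = subst (_≢ w) (sym (v-vert k))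
    same : Same (vert i) (vert j)
    same = subst₂ Same (v-vert i) (v-vert j)
      ([ (λ i≤j → same-≤ i≤j (≤-pred (toℕ<n j)) (lift i vi≢) (lift j vj≢))
       , (λ j≤i → same-sym (same-≤ j≤i (≤-pred (toℕ<n i)) (lift j vj≢) (lift i vi≢))) ]′ (≤-total (toℕ i) (toℕ j)))

-- The extremal graphs

module Extremal (r ζ M′ : ℕ) (1≤r : 1 ≤ r) (3≤ζ : 3 ≤ ζ) where

  -- The number of copies. Two are enough for the radius; `M′` is left free so that the colour count
  -- can ask for many more.
  M : ℕ
  M = 2 + M′

  span : ℕ → ℕ
  span i = pred ((2 * suc i + 1) ⊓ ζ)

  suc-span : ∀ i → suc (span i) ≡ (2 * suc i + 1) ⊓ ζ
  suc-span i = suc-pred _ {{>-nonZero (⊓-glb (m≤n+m 1 (2 * suc i)) (≤-trans (s≤s z≤n) 3≤ζ))}}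

  2≤span : ∀ i → 2 ≤ span i
  2≤span i = ≤-pred (subst (3 ≤_) (sym (suc-span i))
    (⊓-glb (≤-trans (m≤n+m 3 (2 * i)) (≤-reflexive (lemma i))) 3≤ζ))
    where
    open +-*-Solver
    lemma : ∀ i → 2 * i + 3 ≡ 2 * suc i + 1
    lemma = solve 1 (λ i → con 2 :* i :+ con 3 := con 2 :* (con 1 :+ i) :+ con 1) refl

  span≤ζ : ∀ i → suc (span i) ≤ ζ
  span≤ζ i = subst (_≤ ζ) (sym (suc-span i)) (m⊓n≤n _ ζ)

  span≤ : ∀ i → span i ≤ suc i + suc i
  span≤ i = ≤-pred (subst₂ _≤_ (sym (suc-span i)) (lemma i) (m⊓n≤m (2 * suc i + 1) ζ))
    where
    open +-*-Solver
    lemma : ∀ i → 2 * suc i + 1 ≡ suc (suc i + suc i)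
    lemma = solve 1 (λ i → con 2 :* (con 1 :+ i) :+ con 1 := con 1 :+ (con 1 :+ i :+ (con 1 :+ i))) refl

  -- Each copy is the path 0, 1, …, t r with chords joining t i and t (suc i): cycles of lengths
  -- suc (span i), consecutive ones sharing a cut vertex. The copies are glued at the centre t r.
  t : ℕ → ℕ
  t zero    = 0
  t (suc i) = t i + span i

  -- The bound counts edges: the first `i` cycles of a copy consist of `t i` path edges and `i`
  -- chords.
  t+i≡bound : ∀ i → t i + i ≡ bound ζ i
  t+i≡bound zero    = refl
  t+i≡bound (suc i) = trans (lemma (t i) (span i) i) (cong₂ _+_ (t+i≡bound i) (suc-span i))
    where
    open +-*-Solver
    lemma : ∀ a b i → a + b + suc i ≡ a + i + suc b
    lemma = solve 3 (λ a b i → a :+ b :+ (con 1 :+ i) := a :+ i :+ (con 1 :+ b)) refl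

  t-step : ∀ i → 2 + t i ≤ t (suc i)
  t-step i = subst (_≤ t (suc i)) (+-comm (t i) 2) (+-monoʳ-≤ (t i) (2≤span i))

  t-< : ∀ i → t i < t (suc i)
  t-< i = <⇒≤ (t-step i)

  t-mono : ∀ {i j} → i ≤ j → t i ≤ t j
  t-mono {i} {j} i≤j = subst (λ k → t i ≤ t k) (m+[n∸m]≡n i≤j) (go (j ∸ i))
    where
    go : ∀ k → t i ≤ t (i + k)
    go zero    = ≤-reflexive (cong t (sym (+-identityʳ i)))
    go (suc k) = ≤-trans (go k) (≤-trans (<⇒≤ (t-< (i + k))) (≤-reflexive (cong t (sym (+-suc i k)))))

  t-reflects-< : ∀ {i j} → t i < t j → i < j
  t-reflects-< {i} {j} h = ≰⇒> λ j≤i → <⇒≱ h (t-mono j≤i)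

  t-injective : ∀ {i j} → t i ≡ t j → i ≡ j
  t-injective {i} {j} eq = ≤-antisym
    (≮⇒≥ λ j<i → <-irrefl (sym eq) (≤-trans (t-< j) (t-mono j<i)))
    (≮⇒≥ λ i<j → <-irrefl eq (≤-trans (t-< i) (t-mono i<j)))

  block : ∀ k {u} → u < t k → ∃ λ i → i < k × t i ≤ u × u < t (suc i)
  block (suc k) {u} h with u <? t k
  ... | yes u< with i , i<k , lo , hi ← block k u< = i , m≤n⇒m≤1+n i<k , lo , hi
  ... | no  u≮ = k , n<1+n k , ≮⇒≥ u≮ , h

  block-unique : ∀ {i j u} → t i ≤ u → u < t (suc i) → t j ≤ u → u < t (suc j) → i ≡ j
  block-unique lo hi lo′ hi′ = ≤-antisym
    (≤-pred (t-reflects-< (≤-trans (s≤s lo) hi′))) (≤-pred (t-reflects-< (≤-trans (s≤s lo′) hi)))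

  Z : ℕ
  Z = t r

  0<Z : 0 < Z
  0<Z = ≤-trans (t-< 0) (t-mono 1≤r)

  -- `zero` is the shared centre; every other vertex encodes a copy and a position below `Z` in it.
  -- Through `node`, position `Z` of every copy is the centre.
  V : Set
  V = Fin (suc (M * Z))

  elim : {A : Set} → (Fin M → ℕ → A) → A → V → A
  elim f a zero    = a
  elim f a (suc x) = f (proj₁ (remQuot Z x)) (toℕ (proj₂ (remQuot {M} Z x)))

  opaque
    node : Fin M → ℕ → V
    node m u with u <? Z
    ... | yes u<Z = suc (combine m (fromℕ< u<Z))
    ... | no  _   = zero

    node-centre : ∀ {m u} → Z ≤ u → node m u ≡ zero
    node-centre {m} {u} Z≤u with u <? Z
    ... | yes u<Z = contradiction Z≤u (<⇒≱ u<Z)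
    ... | no  _   = refl

    node-injective : ∀ {m u m′ u′} → u < Z → node m u ≡ node m′ u′ → m ≡ m′ × u ≡ u′
    node-injective {m} {u} {m′} {u′} u<Z eq with u <? Z | u′ <? Z
    ... | no u≮Z | _       = contradiction u<Z u≮Z
    ... | yes _ | no _     = contradiction eq λ ()
    ... | yes p | yes q with m≡ , f≡ ← combine-injective m (fromℕ< p) m′ (fromℕ< q) (Fin.suc-injective eq) =
      m≡ , trans (sym (toℕ-fromℕ< p)) (trans (cong toℕ f≡) (toℕ-fromℕ< q))

    node-elim : ∀ {A : Set} {f : Fin M → ℕ → A} {a} → (∀ m → f m Z ≡ a) → ∀ m {u} → u ≤ Z → elim f a (node m u) ≡ f m u
    node-elim {f = f} {a} centre m {u} u≤Z with u <? Z
    ... | no u≮Z = trans (sym (centre m)) (cong (f m) (≤-antisym (≮⇒≥ u≮Z) u≤Z))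
    ... | yes p  = trans (cong (λ mu → f (proj₁ mu) (toℕ (proj₂ mu))) (remQuot-combine m (fromℕ< p)))
                     (cong (f m) (toℕ-fromℕ< p))

    node-nonzero : ∀ x → ∃₂ λ m u → u < Z × suc x ≡ node m u
    node-nonzero x = proj₁ (remQuot {M} Z x) , toℕ (proj₂ (remQuot {M} Z x)) , toℕ<n _ , eq
      where
      eq : suc x ≡ node (proj₁ (remQuot {M} Z x)) (toℕ (proj₂ (remQuot {M} Z x)))
      eq with toℕ (proj₂ (remQuot {M} Z x)) <? Z
      ... | yes p  = cong suc (trans (sym (combine-remQuot {M} Z x))
                       (cong (combine (proj₁ (remQuot {M} Z x))) (sym (fromℕ<-toℕ _ p))))
      ... | no  ¬p = contradiction (toℕ<n _) ¬p

  node-surjective : ∀ x → ∃₂ λ m u → u ≤ Z × x ≡ node m u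
  node-surjective zero    = zero , Z , ≤-refl , sym (node-centre ≤-refl)
  node-surjective (suc x) with m , u , u<Z , eq ← node-nonzero x = m , u , <⇒≤ u<Z , eq

  node-injectiveʳ : ∀ {m u m′ u′} → u ≤ Z → u′ ≤ Z → node m u ≡ node m′ u′ → u ≡ u′
  node-injectiveʳ {u = u} {u′ = u′} u≤ u′≤ eq with u <? Z | u′ <? Z
  ... | yes p | _     = proj₂ (node-injective p eq)
  ... | no _  | yes q = sym (proj₂ (node-injective q (sym eq)))
  ... | no p  | no q  = trans (≤-antisym u≤ (≮⇒≥ p)) (≤-antisym (≮⇒≥ q) u′≤)

  -- The edges of one copy: path edges, then chords, directed towards the centre.
  Edge : Set
  Edge = Fin Z ⊎ Fin r

  lo hi : Edge → ℕ
  lo (inj₁ u) = toℕ u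
  lo (inj₂ i) = t (toℕ i)
  hi (inj₁ u) = suc (toℕ u)
  hi (inj₂ i) = t (suc (toℕ i))

  lo<hi : ∀ e → lo e < hi e
  lo<hi (inj₁ u) = ≤-refl
  lo<hi (inj₂ i) = t-< (toℕ i)

  hi≤Z : ∀ e → hi e ≤ Z
  hi≤Z (inj₁ u) = toℕ<n u
  hi≤Z (inj₂ i) = t-mono (toℕ<n i)

  lo<Z : ∀ e → lo e < Z
  lo<Z e = ≤-trans (lo<hi e) (hi≤Z e)

  ends-injective : ∀ e e′ → lo e ≡ lo e′ → hi e ≡ hi e′ → e ≡ e′
  ends-injective (inj₁ u) (inj₁ u′) l h = cong inj₁ (toℕ-injective l)
  ends-injective (inj₂ i) (inj₂ i′) l h = cong inj₂ (toℕ-injective (t-injective l))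
  -- A chord spans at least two path edges, so it is never parallel to one.
  ends-injective (inj₁ u) (inj₂ i)  l h = contradiction (trans (cong suc (sym l)) h) (<⇒≢ (t-step (toℕ i)))
  ends-injective (inj₂ i) (inj₁ u)  l h = contradiction (trans (cong suc l) (sym h)) (<⇒≢ (t-step (toℕ i)))

  tail head : Fin M → Edge → V
  tail m e = node m (lo e)
  head m e = node m (hi e)

  -- A tail is never the centre and thus determines its copy; a reversed match would contradict
  -- `lo<hi`.
  sameEdge⇒≡ : ∀ {m e m′ e′} → SameEdge (tail m e) (head m e) (tail m′ e′) (head m′ e′) → m ≡ m′ × e ≡ e′
  sameEdge⇒≡ {m} {e} {m′} {e′} (inj₁ (l , h)) with m≡ , lo≡ ← node-injective (lo<Z e′) l =
    sym m≡ , sym (ends-injective e′ e lo≡ (node-injectiveʳ (hi≤Z e′) (hi≤Z e) h))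
  sameEdge⇒≡ {m} {e} {m′} {e′} (inj₂ (l , h)) =
    contradiction (≤-trans (lo<hi e′) (≤-reflexive (node-injectiveʳ (hi≤Z e′) (<⇒≤ (lo<Z e)) h)))
      (<⇒≯ (≤-trans (lo<hi e) (≤-reflexive (sym (node-injectiveʳ (<⇒≤ (lo<Z e′)) (hi≤Z e) l)))))

  Link : V → V → Set
  Link x y = ∃₂ λ m e → x ≡ tail m e × y ≡ head m e

  opaque
    link? : ∀ x y → Dec (Link x y)
    link? x y = any? λ m → map′
      [ (λ (u , eqs) → inj₁ u , eqs) , (λ (i , eqs) → inj₂ i , eqs) ]′
      (λ { (inj₁ u , eqs) → inj₁ (u , eqs) ; (inj₂ i , eqs) → inj₂ (i , eqs) })
      ((any? λ u → (x ≟ _) ×-dec (y ≟ _)) ⊎-dec (any? λ i → (x ≟ _) ×-dec (y ≟ _)))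

  link-irrefl : ∀ {x} → ¬ Link x x
  link-irrefl (m , e , eq , eq′) =
    <⇒≢ (lo<hi e) (node-injectiveʳ (<⇒≤ (lo<Z e)) (hi≤Z e) (trans (sym eq) eq′))

  opaque
    𝔾 : Graph (suc (M * Z))
    𝔾 = record
      { adj     = λ x y → does (link? x y) ∨ does (link? y x)
      ; adj-sym = λ x y → 𝔹.∨-comm (does (link? x y)) (does (link? y x))
      ; irrefl  = λ x → cong₂ _∨_ (dec-false (link? x x) link-irrefl) (dec-false (link? x x) link-irrefl)
      }

    adj⁻ : ∀ {x y} → adj 𝔾 x y ≡ true → Link x y ⊎ Link y x
    adj⁻ {x} {y} e with link? x y | link? y x
    ... | yes l | _     = inj₁ l
    ... | no _  | yes l = inj₂ l

    adj⁺ : ∀ m e → adj 𝔾 (tail m e) (head m e) ≡ true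
    adj⁺ m e = cong (_∨ does (link? (head m e) (tail m e)))
                      (dec-true (link? (tail m e) (head m e)) (m , e , refl , refl))

  long : ∀ {u} → u < Z → Edge
  long u<Z = inj₁ (fromℕ< u<Z)

  chord : ∀ {i} → i < r → Edge
  chord i<r = inj₂ (fromℕ< i<r)

  module _ (G : Graph (suc (M * Z))) (m : Fin M) where

    Present : Edge → Set
    Present e = adj G (tail m e) (head m e) ≡ true

    path : ∀ u k → u + k ≤ Z → (∀ (j : Fin Z) → u ≤ toℕ j → toℕ j < u + k → Present (inj₁ j)) →
           Reach G k (node m u) (node m (u + k))
    path u zero    le present = subst (λ v → Reach G 0 (node m u) (node m v)) (sym (+-identityʳ u)) ([] , refl)
    path u (suc k) le present = subst₂ (λ l v → Reach G l (node m u) (node m v)) (+-comm k 1) (sym (+-suc u k))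
      (reach-++ (path u k (<⇒≤ le′) λ j u≤ j< → present j u≤ (≤-trans j< (<⇒≤ last))) (reach-edge e))
      where
      le′ : u + k < Z
      le′ = subst (_≤ Z) (+-suc u k) le
      last : u + k < u + suc k
      last = ≤-reflexive (sym (+-suc u k))
      j≡ : toℕ (fromℕ< le′) ≡ u + k
      j≡ = toℕ-fromℕ< le′
      e : adj G (node m (u + k)) (node m (suc (u + k))) ≡ true
      e = subst (λ j → adj G (node m j) (node m (suc j)) ≡ true) j≡
        (present (fromℕ< le′) (≤-trans (m≤m+n u k) (≤-reflexive (sym j≡))) (subst (_< u + suc k) (sym j≡) last))

    path-≤ : ∀ {u v} → u ≤ v → v ≤ Z → (∀ (j : Fin Z) → u ≤ toℕ j → toℕ j < v → Present (inj₁ j)) →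
             Reach G (v ∸ u) (node m u) (node m v)
    path-≤ {u} {v} u≤v v≤Z present = subst (λ w → Reach G (v ∸ u) (node m u) (node m w)) eq
      (path u (v ∸ u) (≤-trans (≤-reflexive eq) v≤Z) λ j u≤ j< → present j u≤ (≤-trans j< (≤-reflexive eq)))
      where
      eq = m+[n∸m]≡n u≤v

    chord-edge : ∀ {i} (i<r : i < r) → Present (chord i<r) → adj G (node m (t i)) (node m (t (suc i))) ≡ true
    chord-edge i<r = subst (λ j → adj G (node m (t j)) (node m (t (suc j))) ≡ true) (toℕ-fromℕ< i<r)

  -- Bridgelessness of the extremal graph

  𝔾-path : ∀ m {u v} → u ≤ v → v ≤ Z → Reach 𝔾 (v ∸ u) (node m u) (node m v)
  𝔾-path m u≤v v≤Z = path-≤ 𝔾 m u≤v v≤Z λ j _ _ → adj⁺ m (inj₁ j)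

  to-centre : ∀ x → Walk 𝔾 x zero
  to-centre x with m , u , u≤Z , refl ← node-surjective x =
    subst (Walk 𝔾 (node m u)) (node-centre ≤-refl) (proj₁ (𝔾-path m u≤Z ≤-refl))

  connected : Connected 𝔾
  connected x y = to-centre x ++ʷ revʷ (to-centre y)

  module _ (m : Fin M) (e : Edge) where

    𝔾∖ : Graph (suc (M * Z))
    𝔾∖ = deleteEdge 𝔾 (tail m e) (head m e)

    present : ∀ e′ → e′ ≢ e → Present 𝔾∖ m e′
    present e′ ≢e = delete-edge⁺ 𝔾 (adj⁺ m e′) λ same → ≢e (sym (proj₂ (sameEdge⇒≡ same)))

  around-chord : ∀ m i → Reach (𝔾∖ m (inj₂ i)) (t (suc (toℕ i)) ∸ t (toℕ i))
                               (node m (t (toℕ i))) (node m (t (suc (toℕ i))))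
  around-chord m i = path-≤ (𝔾∖ m (inj₂ i)) m (<⇒≤ (t-< (toℕ i))) (t-mono (toℕ<n i))
    λ j _ _ → present m (inj₂ i) (inj₁ j) λ ()

  around : ∀ m e → Walk (𝔾∖ m e) (tail m e) (head m e)
  -- Go round the cycle containing the path edge: back to its start `t i`, over the chord, and back
  -- from `t (suc i)`.
  around m e@(inj₁ u) with i , i<r , t≤u , u<t ← block r (toℕ<n u) =
    revʷ (proj₁ (path-≤ (𝔾∖ m e) m t≤u (<⇒≤ (toℕ<n u)) λ j _ j<u →
      present m e (inj₁ j) λ { refl → <-irrefl refl j<u })) ++ʷ
    (chord-edge (𝔾∖ m e) m i<r (present m e (chord i<r) λ ()) ∷
    revʷ (proj₁ (path-≤ (𝔾∖ m e) m u<t (t-mono i<r) λ j u<j _ →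
      present m e (inj₁ j) λ { refl → <-irrefl refl u<j })))
  around m (inj₂ i) = proj₁ (around-chord m i)

  bridgeless : Bridgeless 𝔾
  bridgeless = connected , λ x y e → case adj⁻ e of λ
    { (inj₁ (m , e , refl , refl)) → connected-delete connected (around m e)
    ; (inj₂ (m , e , refl , refl)) → connected-delete connected (delete-swap 𝔾 (revʷ (around m e)))
    }

  -- Radius of the extremal graph

  chords : ∀ m k j → j + k ≡ r → Reach 𝔾 k (node m (t j)) zero
  chords m zero    j eq = subst (Reach 𝔾 0 (node m (t j)))
    (node-centre (≤-reflexive (cong t (trans (sym eq) (+-identityʳ j))))) ([] , refl)
  chords m (suc k) j eq = reach-++ (reach-edge (chord-edge 𝔾 m j<r (adj⁺ m (chord j<r))))
                                   (chords m k (suc j) (trans (sym (+-suc j k)) eq))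
    where
    j<r : j < r
    j<r = subst (j <_) eq (≤-trans (≤-reflexive (+-comm 1 j)) (+-monoʳ-≤ j (s≤s z≤n)))

  -- A vertex in the cycle from `t i` to `t (suc i)` has at most 2(`i` + 1) path edges ahead and
  -- behind together. So it is within `suc i` of the near cut vertex, or within `i` of the far one,
  -- and chords finish the way.
  within : ∀ x → DistLE 𝔾 zero x r
  within x with m , u , u≤Z , refl ← node-surjective x with u <? Z
  ... | no  u≮Z = subst (λ y → DistLE 𝔾 zero y r) (sym (node-centre (≮⇒≥ u≮Z))) ([] , z≤n)
  ... | yes u<Z with i , i<r , t≤u , u<t ← block r u<Z = go (ahead ≤? suc i)
    where
    ahead = t (suc i) ∸ u
    behind = u ∸ t i
    k = r ∸ suc i
    k+ : suc i + k ≡ r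
    k+ = m+[n∸m]≡n i<r
    total : ahead + behind ≡ span i
    total = begin-equality
      ahead + (u ∸ t i)     ≡⟨ sym (+-∸-assoc ahead t≤u) ⟩
      (ahead + u) ∸ t i     ≡⟨ cong (_∸ t i) (m∸n+n≡m (<⇒≤ u<t)) ⟩
      (t i + span i) ∸ t i  ≡⟨ m+n∸m≡n (t i) (span i) ⟩
      span i                ∎
      where open ≤-Reasoning
    finish : ∀ {l} → l ≤ suc i → Reach 𝔾 (l + k) (node m u) zero → DistLE 𝔾 zero (node m u) r
    finish l≤ w with q , eq ← reach-rev w =
      q , ≤-trans (≤-reflexive eq) (≤-trans (+-monoˡ-≤ k l≤) (≤-reflexive k+))
    go : Dec (ahead ≤ suc i) → DistLE 𝔾 zero (node m u) r
    go (yes le) = finish le (reach-++ (𝔾-path m (<⇒≤ u<t) (t-mono i<r)) (chords m k (suc i) k+))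
    go (no ¬le) = finish (s≤s behind≤) (subst (λ l → Reach 𝔾 l (node m u) zero) (+-suc behind k)
      (reach-++ (reach-rev (𝔾-path m t≤u u≤Z)) (chords m (suc k) i (trans (+-suc i k) k+))))
      where
      behind≤ : behind ≤ i
      behind≤ = +-cancelˡ-≤ (2 + i) behind i (begin
        2 + i + behind  ≤⟨ +-monoˡ-≤ behind (≰⇒> ¬le) ⟩
        ahead + behind  ≡⟨ total ⟩
        span i          ≤⟨ span≤ i ⟩
        suc i + suc i   ≡⟨ +-suc (suc i) i ⟩
        2 + i + i       ∎)
        where open ≤-Reasoning

  Close : ℕ → ℕ → Set
  Close a b = a ≤ suc b × b ≤ suc a

  close-refl : ∀ {a b} → a ≡ b → Close a b
  close-refl refl = n≤1+n _ , n≤1+n _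

  module _ (f : Fin M → ℕ → ℕ) {a : ℕ} (centre : ∀ m → f m Z ≡ a) where

    elim-close : ∀ m e → Close (f m (lo e)) (f m (hi e)) → Close (elim f a (tail m e)) (elim f a (head m e))
    elim-close m e = subst₂ Close (sym (node-elim centre m (<⇒≤ (lo<Z e)))) (sym (node-elim centre m (hi≤Z e)))

  -- The least `i` with `u ≤ t i`, capped at `k`. It counts the chords from 0 and changes by at most
  -- one along every edge.
  lvl : ℕ → ℕ → ℕ
  lvl zero    u = 0
  lvl (suc k) u with u ≤? t k
  ... | yes _ = lvl k u
  ... | no  _ = suc k

  lvl≤ : ∀ k u → lvl k u ≤ k
  lvl≤ zero    u = z≤n
  lvl≤ (suc k) u with u ≤? t k
  ... | yes _ = m≤n⇒m≤1+n (lvl≤ k u)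
  ... | no  _ = ≤-refl

  lvl-t : ∀ k {i} → i ≤ k → lvl k (t i) ≡ i
  lvl-t zero    z≤n = refl
  lvl-t (suc k) {i} i≤ with t i ≤? t k
  ... | yes le = lvl-t k (≮⇒≥ λ k<i → <⇒≱ (t-< k) (≤-trans (t-mono k<i) le))
  ... | no ¬le = ≤-antisym (≰⇒> λ i≤k → ¬le (t-mono i≤k)) i≤

  lvl-close : ∀ k u → Close (lvl k u) (lvl k (suc u))
  lvl-close zero    u = z≤n , z≤n
  lvl-close (suc k) u with u ≤? t k | suc u ≤? t k
  ... | yes _ | yes _   = lvl-close k u
  ... | yes p | no q    = m≤n⇒m≤1+n (m≤n⇒m≤1+n (lvl≤ k u)) ,
    s≤s (≤-reflexive (sym (trans (cong (lvl k) (≤-antisym p (≮⇒≥ q))) (lvl-t k ≤-refl))))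
  ... | no p  | yes q   = contradiction (<⇒≤ q) p
  ... | no _  | no _    = n≤1+n _ , n≤1+n _

  module _ (m : Fin M) where

    height : Fin M → ℕ → ℕ
    height m′ u = if does (m′ ≟ m) then lvl r u else r

    height-centre : ∀ m′ → height m′ Z ≡ r
    height-centre m′ with m′ ≟ m
    ... | yes _ = lvl-t r ≤-refl
    ... | no _  = refl

    height-close : ∀ m′ e → Close (height m′ (lo e)) (height m′ (hi e))
    height-close m′ e with m′ ≟ m
    ... | no _  = n≤1+n _ , n≤1+n _
    height-close m′ (inj₁ u) | yes _ = lvl-close r (toℕ u)
    height-close m′ (inj₂ i) | yes _ = subst₂ Close (sym (lvl-t r (<⇒≤ (toℕ<n i)))) (sym (lvl-t r (toℕ<n i)))
      (m≤n⇒m≤1+n (n≤1+n _) , ≤-refl)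

    -- The height is `lvl` on copy `m` and constantly `r` on the others, so a walk from another copy
    -- to the end of copy `m` descends from `r` to 0.
    far : ∀ {m′} → m′ ≢ m → ∀ {u} → u ≤ Z → (p : Walk 𝔾 (node m′ u) (node m 0)) → r ≤ length p
    far {m′} m′≢m {u} u≤Z p = subst₂ _≤_
      (trans (node-elim height-centre m′ u≤Z) other)
      (trans (cong (_+ length (revʷ p)) (trans (node-elim height-centre m z≤n) own)) (length-revʷ p))
      (lipschitz (elim height r) lip (revʷ p))
      where
      own : height m 0 ≡ 0
      own with m ≟ m
      ... | yes _ = lvl-t r z≤n
      ... | no ≢m = contradiction refl ≢m
      other : height m′ u ≡ r
      other with m′ ≟ m
      ... | yes m′≡m = contradiction m′≡m m′≢m
      ... | no _     = refl
      lip : ∀ {x y} → adj 𝔾 x y ≡ true → elim height r y ≤ suc (elim height r x)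
      lip e with adj⁻ e
      ... | inj₁ (m , e , refl , refl) = proj₂ (elim-close height height-centre m e (height-close m e))
      ... | inj₂ (m , e , refl , refl) = proj₁ (elim-close height height-centre m e (height-close m e))

  radius : Radius 𝔾 r
  radius = (zero , within) , eccentric
    where
    eccentric : ∀ x → ∃ λ y → ∀ (p : Walk 𝔾 x y) → r ≤ length p
    eccentric x with m , u , u≤Z , refl ← node-surjective x with m ≟ zero
    -- The distant vertex is the end of a copy other than the one of `x`.
    ... | yes m≡0 = node (suc zero) 0 , far (suc zero) (λ m≡1 → case trans (sym m≡0) m≡1 of λ ()) u≤Z
    ... | no  m≢0 = node zero 0 , far zero m≢0 u≤Z

  -- The largest isometric cycle of the extremal graph

  module _ (m : Fin M) (i : Fin r) (last : suc (toℕ i) ≡ r) where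

    private
      e₀ : Edge
      e₀ = inj₂ i

      t≤Z : t (toℕ i) ≤ Z
      t≤Z = t-mono (<⇒≤ (toℕ<n i))

    -- A height for the graph without the last chord: earlier cycles collapse to `t (toℕ i)` and
    -- other copies to `Z`, so only the edges of the last path segment change it, each by one.
    position : Fin M → ℕ → ℕ
    position m′ u = if does (m′ ≟ m) then t (toℕ i) ⊔ u else Z

    position-centre : ∀ m′ → position m′ Z ≡ Z
    position-centre m′ with m′ ≟ m
    ... | yes _ = m≤n⇒m⊔n≡n t≤Z
    ... | no _  = refl

    position-own : ∀ u → position m u ≡ t (toℕ i) ⊔ u
    position-own u with m ≟ m
    ... | yes _ = refl
    ... | no ≢m = contradiction refl ≢m

    position-close : ∀ m′ e → ¬ (m′ ≡ m × e ≡ e₀) → Close (position m′ (lo e)) (position m′ (hi e))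
    position-close m′ e ≢e₀ with m′ ≟ m
    ... | no _ = n≤1+n _ , n≤1+n _
    position-close m′ (inj₁ u) ≢e₀ | yes _ =
      m≤n⇒m≤1+n (⊔-monoʳ-≤ (t (toℕ i)) (n≤1+n _)) ,
      ⊔-lub (m≤n⇒m≤1+n (m≤m⊔n _ _)) (s≤s (m≤n⊔m (t (toℕ i)) (toℕ u)))
    position-close m′ (inj₂ j) ≢e₀ | yes m′≡m = close-refl
      (trans (m≥n⇒m⊔n≡m (t-mono (<⇒≤ j<i))) (sym (m≥n⇒m⊔n≡m (t-mono j<i))))
      where
      j<i : toℕ j < toℕ i
      j<i = ≤∧≢⇒< (≤-pred (subst (toℕ j <_) (sym last) (toℕ<n j)))
                  (λ eq → ≢e₀ (m′≡m , cong inj₂ (toℕ-injective eq)))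

    around-shortest : (q : Walk (𝔾∖ m e₀) (head m e₀) (tail m e₀)) → t (suc (toℕ i)) ∸ t (toℕ i) ≤ length q
    around-shortest q = m≤n+o⇒m∸n≤o (t (suc (toℕ i))) (t (toℕ i)) (subst₂ _≤_
      (trans (node-elim {f = position} position-centre m (hi≤Z e₀))
        (trans (position-own _) (m≤n⇒m⊔n≡n (<⇒≤ (t-< (toℕ i))))))
      (cong₂ _+_ (trans (node-elim {f = position} position-centre m t≤Z) (trans (position-own _) (⊔-idem (t (toℕ i)))))
        (length-revʷ q))
      (lipschitz (elim position Z) lip (revʷ q)))
      where
      lip : ∀ {x y} → adj (𝔾∖ m e₀) x y ≡ true → elim position Z y ≤ suc (elim position Z x)
      lip e with e′ , ≢e ← delete-edge⁻ 𝔾 e with adj⁻ e′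
      ... | inj₁ (m′ , e , refl , refl) = proj₂ (elim-close position position-centre m′ e
              (position-close m′ e λ { (refl , refl) → ≢e (inj₁ (refl , refl)) }))
      ... | inj₂ (m′ , e , refl , refl) = proj₁ (elim-close position position-centre m′ e
              (position-close m′ e λ { (refl , refl) → ≢e (inj₂ (refl , refl)) }))

    last-cycle : IsoCycle 𝔾 (suc (span (toℕ i)))
    last-cycle with p , len ← reach-rev (around-chord m i) = subst (IsoCycle 𝔾 ∘ suc)
      (trans len (m+n∸m≡n (t (toℕ i)) (span (toℕ i))))
      (shortest⇒isoCycle 𝔾 (adj⁺ m e₀) p λ q → ≤-trans (≤-reflexive len) (around-shortest q))

  Below : Fin M → ℕ → V → Set
  Below m s x = ∃ λ u → u < s × x ≡ node m u

  below? : ∀ m s x → Dec (Below m s x)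
  below? m s x = map′
    (λ (u , eq) → toℕ u , toℕ<n u , eq)
    (λ (u , u< , eq) → fromℕ< u< , trans eq (cong (node m) (sym (toℕ-fromℕ< u<))))
    (any? {n = s} λ u → x ≟ node m (toℕ u))

  below-exit : ∀ {m s} → s ≤ Z → ∀ {x y} → adj 𝔾 x y ≡ true → Below m s x → ¬ Below m s y →
               ∃ λ e → (lo e < s × s ≤ hi e) × x ≡ tail m e × y ≡ head m e
  below-exit s≤Z e (u , u< , x≡) y∉ with adj⁻ e
  ... | inj₁ (m′ , e , refl , refl) with refl , refl ← node-injective (lo<Z e) x≡ =
    e , (u< , ≮⇒≥ λ hi< → y∉ (hi e , hi< , refl)) , refl , refl
  ... | inj₂ (m′ , e , refl , refl) with refl , refl ← node-injective (≤-trans u< s≤Z) (sym x≡) =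
    contradiction (lo e , <-trans (lo<hi e) u< , refl) y∉

  -- No chord jumps over a cut vertex.
  below-t-exit : ∀ {m i} → i ≤ r → ∀ {x y} → adj 𝔾 x y ≡ true → Below m (t i) x → ¬ Below m (t i) y → y ≡ node m (t i)
  below-t-exit {m} {i} i≤r e x∈ y∉ with below-exit (t-mono i≤r) e x∈ y∉
  ... | inj₁ u , (lo< , hi≥) , _ , refl = cong (node m) (≤-antisym lo< hi≥)
  ... | inj₂ j , (lo< , hi≥) , _ , refl = cong (node m) (≤-antisym (t-mono (t-reflects-< {toℕ j} {i} lo<)) hi≥)

  -- Take a copy that the cycle meets off the centre, and the least cut vertex below which it has a
  -- vertex. `cycle-confined` bounds its positions above and minimality bounds them below, so its
  -- vertices inject into one cycle of the chain.
  longest : ∀ L → IsoCycle 𝔾 L → L ≤ ζ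
  longest zero    _     = z≤n
  longest (suc L) cycle = go (proj₁ (proj₂ least-meeting)) (proj₂ (proj₂ least-meeting))
    where
    open IsoCycle cycle

    Meets : Fin M → ℕ → Set
    Meets m i = ∃ λ k → Below m (t i) (vert k)

    meets-branch : ∃ λ m → Meets m r
    -- Of two distinct cycle vertices at most one is the centre.
    meets-branch with vert zero in eq | vert (fromℕ< {1} (<⇒≤ three≤L)) in eq′
    ... | suc x | _     with m , u , u<Z , x≡ ← node-nonzero x = m , zero , u , u<Z , trans eq x≡
    ... | zero  | suc x with m , u , u<Z , x≡ ← node-nonzero x = m , _ , u , u<Z , trans eq′ x≡
    ... | zero  | zero  = contradiction (trans (cong toℕ (injective (trans eq (sym eq′))))
                            (toℕ-fromℕ< (<⇒≤ three≤L))) λ ()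

    m : Fin M
    m = proj₁ meets-branch

    least-meeting : ∃ λ i → Meets m i × (∀ {j} → Meets m j → i ≤ j)
    least-meeting = least (λ i → any? λ k → below? m (t i) (vert k)) {r} (proj₂ meets-branch)

    go : ∀ {i} → Meets m i → (∀ {j} → Meets m j → i ≤ j) → suc L ≤ ζ
    go {zero} (_ , _ , () , _) _
    go {suc i} (k₀ , k₀∈) min = ≤-trans (Fin.injective⇒≤ {f = offset} offset-injective) (span≤ζ i)
      where
      i<r : suc i ≤ r
      i<r = min (proj₂ meets-branch)
      located : ∀ k → ∃ λ u → (t i ≤ u × u ≤ t (suc i)) × vert k ≡ node m u
      located k with cycle-confined cycle (below? m (t (suc i))) (below-t-exit i<r) centre∉ k₀ k k₀∈
        where
        centre∉ : ¬ Below m (t (suc i)) (node m (t (suc i)))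
        centre∉ (u , u< , eq) = <⇒≢ u< (sym (node-injectiveʳ (t-mono i<r) (≤-trans (<⇒≤ u<) (t-mono i<r)) eq))
      ... | inj₂ eq = t (suc i) , (<⇒≤ (t-< i) , ≤-refl) , eq
      ... | inj₁ (u , u< , eq) = u , (≮⇒≥ (λ u<t → <-irrefl refl (min (k , u , u<t , eq))) , <⇒≤ u<) , eq
      offset< : ∀ k → proj₁ (located k) ∸ t i < suc (span i)
      offset< k with u , (_ , u≤) , _ ← located k = s≤s (m≤n+o⇒m∸n≤o u (t i) u≤)
      offset : Fin (suc L) → Fin (suc (span i))
      offset k = fromℕ< (offset< k)
      offset-injective : Injective _≡_ _≡_ offset
      offset-injective {k} {k′} eq = injective (trans (proj₂ (proj₂ (located k)))
        (trans (cong (node m) u≡) (sym (proj₂ (proj₂ (located k′))))))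
        where
        u≡ : proj₁ (located k) ≡ proj₁ (located k′)
        u≡ = ∸-cancelʳ-≡ (proj₁ (proj₁ (proj₂ (located k)))) (proj₁ (proj₁ (proj₂ (located k′))))
          (trans (sym (toℕ-fromℕ< (offset< k))) (trans (cong toℕ eq) (toℕ-fromℕ< (offset< k′))))

  iso : ζ ≤ 2 * r + 1 → Iso 𝔾 ζ
  iso ζ≤ = subst (IsoCycle 𝔾) ζ≡ (last-cycle zero i last) , longest
    where
    r≡ : suc (pred r) ≡ r
    r≡ = suc-pred r {{>-nonZero 1≤r}}
    i : Fin r
    i = fromℕ< {pred r} (≤-reflexive r≡)
    last : suc (toℕ i) ≡ r
    last = trans (cong suc (toℕ-fromℕ< _)) r≡
    ζ≡ : suc (span (toℕ i)) ≡ ζ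
    ζ≡ = trans (suc-span (toℕ i)) (m≥n⇒m⊓n≡n (subst (λ k → ζ ≤ 2 * k + 1) (sym last) ζ≤))

  -- Lower bound on the number of colours

  module _ {K} (few : K ^ (Z + r) < M) (rc : RainbowColouring 𝔾 K) where

    open RainbowColouring rc

    private
      edgeColour : Fin M → Edge → Fin K
      edgeColour m e = colour (tail m e) (head m e)

      copyColouring : Fin M → Fin (Z + r) → Fin K
      copyColouring m j = edgeColour m (splitAt Z j)

      -- There are more copies than ways to colour one copy, so two are coloured alike.
      twins : ∃₂ λ A B → A ≢ B × (∀ e → edgeColour A e ≡ edgeColour B e)
      twins = let A , B , A<B , eq = pigeonhole few (funToFin ∘ copyColouring) in
        A , B , (λ A≡B → <⇒≢ A<B (cong toℕ A≡B)) , λ e →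
          subst (λ e → edgeColour A e ≡ edgeColour B e) (splitAt-join Z r e)
            (agree (copyColouring A) (copyColouring B) eq (join Z r e))
        where
        agree : (f g : Fin (Z + r) → Fin K) → funToFin f ≡ funToFin g → ∀ j → f j ≡ g j
        agree f g eq j = trans (sym (finToFun-funToFin f j))
          (trans (cong (λ k → finToFun k j) eq) (finToFun-funToFin g j))

    module _ {A B} (A≢B : A ≢ B) (twin : ∀ e → edgeColour A e ≡ edgeColour B e)
             (p : Walk 𝔾 (node A 0) (node B 0)) (uniq : Unique (colours colour p)) where

      private
        Uses : Fin M → Edge → Set
        Uses m e = On p (tail m e) (head m e)

        uses-injective : ∀ {m m′} e e′ → Uses m e → Uses m′ e′ → edgeColour m e ≡ edgeColour m′ e′ → m ≡ m′ × e ≡ e′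
        uses-injective e e′ on on′ eq = sameEdge⇒≡ (on-distinct symmetric p uniq on on′ eq)

        Cut : Fin M → ℕ → Set
        Cut m u = Crossing {G = 𝔾} (below? m (suc u)) p

        below-own : ∀ m u → Below m (suc u) (node m 0)
        below-own m u = 0 , s≤s z≤n , refl

        below-other : ∀ {m m′ u} → m′ ≢ m → u < Z → ¬ Below m (suc u) (node m′ 0)
        below-other m′≢m u<Z (v , _ , eq) = m′≢m (proj₁ (node-injective 0<Z eq))

        cut-A : ∀ {u} → u < Z → Cut A u
        cut-A {u} u<Z = crossing-out (below? A (suc u)) p (below-own A u) (below-other (A≢B ∘ sym) u<Z)

        cut-B : ∀ {u} → u < Z → Cut B u
        cut-B {u} u<Z = crossing-in (below? B (suc u)) p (below-other A≢B u<Z) (below-own B u)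

        -- The edges of a copy that leave {0, …, u} are the path edge at u and the chord over it.
        cut-edges : ∀ {m} u j → t (toℕ j) ≤ toℕ u → toℕ u < t (suc (toℕ j)) → Cut m (toℕ u) →
                    Uses m (inj₁ u) ⊎ Uses m (inj₂ j)
        cut-edges u j t≤u u<t (x , y , e , x∈ , y∉ , on) with below-exit (toℕ<n u) e x∈ y∉
        ... | inj₁ u′ , (lo≤ , hi≥) , refl , refl =
          inj₁ (subst (λ u → Uses _ (inj₁ u)) (toℕ-injective (≤-antisym (≤-pred lo≤) (≤-pred hi≥))) on)
        ... | inj₂ j′ , (lo≤ , hi≥) , refl , refl =
          inj₂ (subst (λ j → Uses _ (inj₂ j)) (toℕ-injective (block-unique (≤-pred lo≤) hi≥ t≤u u<t)) on)

        not-both : ∀ e → Uses A e → Uses B e → ⊥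
        not-both e on on′ = A≢B (proj₁ (uses-injective e e on on′ (twin e)))

        -- The walk crosses the two-edge cut at `u` in each twin. It cannot use the same edge in
        -- both, since these have the same colour, so one twin contributes the path edge and the
        -- other the chord.
        both-used : ∀ u j → t (toℕ j) ≤ toℕ u → toℕ u < t (suc (toℕ j)) →
                    (Uses A (inj₁ u) × Uses B (inj₂ j)) ⊎ (Uses A (inj₂ j) × Uses B (inj₁ u))
        both-used u j t≤u u<t
          with cut-edges u j t≤u u<t (cut-A (toℕ<n u)) | cut-edges u j t≤u u<t (cut-B (toℕ<n u))
        ... | inj₁ a | inj₁ b = contradiction b (not-both (inj₁ u) a)
        ... | inj₁ a | inj₂ b = inj₁ (a , b)
        ... | inj₂ a | inj₁ b = inj₂ (a , b)
        ... | inj₂ a | inj₂ b = contradiction b (not-both (inj₂ j) a)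

        -- The edge may be walked in either twin; its colour is that of the edge in copy `A`.
        Used : Edge → Set
        Used e = ∃ λ m → Uses m e × edgeColour A e ≡ edgeColour m e

        used-block : ∀ u j → t (toℕ j) ≤ toℕ u → toℕ u < t (suc (toℕ j)) → Used (inj₁ u) × Used (inj₂ j)
        used-block u j t≤u u<t with both-used u j t≤u u<t
        ... | inj₁ (a , b) = (A , a , refl) , (B , b , twin (inj₂ j))
        ... | inj₂ (a , b) = (B , b , twin (inj₁ u)) , (A , a , refl)

        used : ∀ e → Used e
        used (inj₁ u) = let i , i<r , t≤u , u<t = block r (toℕ<n u) in
          proj₁ (used-block u (fromℕ< i<r)
            (subst (λ i → t i ≤ toℕ u) (sym (toℕ-fromℕ< i<r)) t≤u)
            (subst (λ i → toℕ u < t (suc i)) (sym (toℕ-fromℕ< i<r)) u<t))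
        used (inj₂ j) = proj₂ (used-block (fromℕ< t<Z) j
          (≤-reflexive (sym (toℕ-fromℕ< t<Z))) (subst (_< t (suc (toℕ j))) (sym (toℕ-fromℕ< t<Z)) (t-< (toℕ j))))
          where
          t<Z : t (toℕ j) < Z
          t<Z = lo<Z (inj₂ j)

      -- All colours of copy `A` occur on one rainbow walk, where equal colours force equal edges.
      edgeColour-injective : ∀ {e e′} → edgeColour A e ≡ edgeColour A e′ → e ≡ e′
      edgeColour-injective {e} {e′} eq =
        let m , on , c = used e ; m′ , on′ , c′ = used e′ in
        proj₂ (uses-injective e e′ on on′ (trans (sym c) (trans eq c′)))

    edges≤colours : Z + r ≤ K
    edges≤colours = let A , B , A≢B , twin = twins ; p , _ , uniq = rainbow (node A 0) (node B 0) in
      Fin.injective⇒≤ {f = copyColouring A} λ {j} {j′} eq →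
        trans (sym (join-splitAt Z r j))
          (trans (cong (join Z r) (edgeColour-injective A≢B twin p uniq {splitAt Z j} {splitAt Z j′} eq))
            (join-splitAt Z r j′))

-- Sharpness and the final statement

sharp : (r ζ : ℕ) → 1 ≤ r → 3 ≤ ζ → ζ ≤ 2 * r + 1 →
        Σ ℕ λ n → Σ (Graph n) λ G → Bridgeless G × Radius G r × Iso G ζ × Rc G (bound ζ r)
sharp r ζ 1≤r 3≤ζ ζ≤ =
  _ , 𝔾 , bridgeless , radius , iso ζ≤ , upper-bound bridgeless radius (iso ζ≤) , λ K rc →
    ≮⇒≥ λ K<B → <⇒≱ K<B (subst (_≤ K) (t+i≡bound r) (edges≤colours (few K<B) rc))
  where
  B = bound ζ r
  -- One copy has `B` edges, so fewer than `B` colours give at most `B ^ B` colourings of it, less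
  -- than the number of copies.
  open Extremal r ζ (B ^ B) 1≤r 3≤ζ
  few : ∀ {K} → K < B → K ^ (Z + r) < M
  few {K} K<B = subst (λ b → K ^ b < M) (sym (t+i≡bound r)) (s≤s (≤-trans (^-monoˡ-≤ B (<⇒≤ K<B)) (n≤1+n _)))

theorem1 : ((n : ℕ) (G : Graph n) (r ζ : ℕ) → Bridgeless G → Radius G r → Iso G ζ →
    RcLE G (bound ζ r) × bound ζ r ≤ r * ζ)
    ×
    ((r ζ : ℕ) → 1 ≤ r → 3 ≤ ζ → ζ ≤ 2 * r + 1 →
    Σ ℕ λ n → Σ (Graph n) λ G →
    Bridgeless G × Radius G r × Iso G ζ × Rc G (bound ζ r))
theorem1 =
  (λ n G r ζ bridgeless radius iso → upper-bound bridgeless radius iso , bound≤ ζ r) , sharp
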